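{- There is a polynomial-time reduction from \texttt{FmDST} to \texttt{G-DCST}.
   Context: For a graph $G$ and a digraph $D$ with vertex set $E(G)$, let $\mathrm{dep}(e)=\{e'\in E(G):(e',e)\in E(D)\}$. Given $\ell,u:E(G)\to\mathbb{N}$, a subgraph $H$ of $G$ $(\ell,u)$-satisfies $D$ if $\ell(e)\le|\mathrm{dep}(e)\cap E(H)|\le u(e)$ for every $e\in E(H)$. \texttt{G-DCST} asks, given $(G,D,\ell,u)$, whether $G$ has a spanning tree that $(\ell,u)$-satisfies $D$. \texttt{FmDST} (Fixed-Leaves Minimum Degree Constrained Spanning Tree): given a graph $G=(V,E)$, a subset $C\subseteq V$, and a function $\ell:C\to\mathbb{Z}^+$, decide whether $G$ has a spanning tree $T$ such that $d_T(v)\ge\ell(v)$ for every $v\in C$ and $d_T(v)=1$ for every $v\in V\setminus C$, where $d_T(v)$ is the degree of $v$ in $T$. -}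

module Defs where

open import Data.Bool using (Bool; true; false)
open import Data.Fin using (Fin; zero; suc)
open import Data.Fin.Subset using (Subset; _∈_; _∉_; _∩_; ∣_∣)
open import Data.Fin.Subset.Properties using (_∈?_)
open import Data.List using (List; []; _∷_; _++_; [_]; map; reverse; replicate; length; concat; tabulate)
open import Data.List.Relation.Unary.Linked using (Linked)
open import Data.List.Relation.Unary.Unique.Propositional using (Unique)
open import Data.Maybe using (Maybe; just; nothing)
open import Data.Nat using (ℕ; zero; suc; _+_; _*_; _^_; _≤_; NonZero)
open import Data.Nat.Binary using (ℕᵇ; zero; 2[1+_]; 1+[2_]; fromℕ)
open import Data.Product using (_×_; _,_; ∃; ∃-syntax; Σ-syntax)
open import Data.Sum using (_⊎_; inj₁)
open import Data.Vec as Vec using (Vec; lookup; toList)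
open import Function.Bundles using (_↔_; _⇔_)
open import Function.Definitions using (Injective)
open import Relation.Binary.Construct.Closure.ReflexiveTransitive using (Star)
open import Relation.Binary.PropositionalEquality using (_≡_; _≢_)
open import Relation.Nullary using (¬_; yes; no)

data Symbol : Set where
  𝟎 𝟏 comma semi : Symbol

Finite : Set → Set
Finite A = ∃[ n ] (A ↔ Fin n)

data Move : Set where
  left stay right : Move

-- Two-way infinite tape: `before` lists the cells to the left of the head,
-- nearest first, `after` those to its right; all cells not listed are blank.
record Tape (Cell : Set) : Set where
  constructor tape
  field
    before : List Cell
    here   : Cell
    after  : List Cell

-- A deterministic Turing machine with an input tape (0), an output tape (1) and
-- `work` further tapes. A cell is blank
-- (`nothing`), an input/output symbol, or an auxiliary symbol of the machine.
-- The machine halts when `δ` returns `nothing`.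
record Machine : Set₁ where
  field
    work         : ℕ
    State        : Set
    Aux          : Set
    state-finite : Finite State
    aux-finite   : Finite Aux

  Cell : Set
  Cell = Maybe (Symbol ⊎ Aux)

  tapes : ℕ
  tapes = 2 + work

  field
    start : State
    δ     : State → Vec Cell tapes → Maybe (State × Vec (Cell × Move) tapes)

module _ (M : Machine) where
  open Machine M

  Config : Set
  Config = State × Vec (Tape Cell) tapes

  act : Cell × Move → Tape Cell → Tape Cell
  act (c , stay)  (tape ls       _ rs)       = tape ls c rs
  act (c , left)  (tape []       _ rs)       = tape [] nothing (c ∷ rs)
  act (c , left)  (tape (l ∷ ls) _ rs)       = tape ls l (c ∷ rs)
  act (c , right) (tape ls       _ [])       = tape (c ∷ ls) nothing []
  act (c , right) (tape ls       _ (r ∷ rs)) = tape (c ∷ ls) r rs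

  step : Config → Maybe Config
  step (q , ts) with δ q (Vec.map Tape.here ts)
  ... | nothing        = nothing
  ... | just (q′ , as) = just (q′ , Vec.zipWith act as ts)

  -- c ⇓[ t ] c′ : started in c, the machine halts after exactly t steps in c′.
  data _⇓[_]_ : Config → ℕ → Config → Set where
    halt : ∀ {c} → step c ≡ nothing → c ⇓[ 0 ] c
    next : ∀ {c c′ c″ t} → step c ≡ just c′ → c′ ⇓[ t ] c″ → c ⇓[ suc t ] c″

  symbols : List Symbol → List Cell
  symbols = map (λ s → just (inj₁ s))

  blankTape : Tape Cell
  blankTape = tape [] nothing []

  inputTape : List Symbol → Tape Cell
  inputTape []      = blankTape
  inputTape (s ∷ w) = tape [] (just (inj₁ s)) (symbols w)

  initial : List Symbol → Config
  initial w = start , inputTape w Vec.∷ Vec.replicate _ blankTape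

  contents : Tape Cell → List Cell
  contents (tape ls c rs) = reverse ls ++ c ∷ rs

  -- The position of the head is irrelevant.
  Holds : Tape Cell → List Symbol → Set
  Holds t w = ∃[ a ] ∃[ b ]
    contents t ≡ replicate a nothing ++ symbols w ++ replicate b nothing

  Computes : List Symbol → List Symbol → ℕ → Set
  Computes v w bound = ∃[ t ] ∃[ q ] ∃[ ts ]
    t ≤ bound × initial v ⇓[ t ] (q , ts) × Holds (lookup ts (suc zero)) w

record DecisionProblem : Set₁ where
  field
    Instance : Set
    encode   : Instance → List Symbol
    Yes      : Instance → Set

open DecisionProblem

PolynomialTime : (A B : DecisionProblem) → (Instance A → Instance B) → Set₁
PolynomialTime A B f = Σ[ M ∈ Machine ] ∃[ c ] ∃[ d ]
  ∀ x → Computes M (encode A x) (encode B (f x)) (c * length (encode A x) ^ d + c)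

infix 4 _≤ₚ_

_≤ₚ_ : DecisionProblem → DecisionProblem → Set₁
A ≤ₚ B = ∃[ f ] ((∀ x → Yes A x ⇔ Yes B (f x)) × PolynomialTime A B f)

-- A finite simple graph: V(G) = Fin order, E(G) = Fin size, and `edge` sends
-- each edge to its set of ends.
record Graph : Set where
  field
    order size : ℕ
    nonempty   : NonZero order
    edge       : Fin size → Subset order
    two-ends   : ∀ e → ∣ edge e ∣ ≡ 2
    simple     : Injective _≡_ _≡_ edge

  V E : Set
  V = Fin order
  E = Fin size

-- A spanning subgraph of G is identified with its edge set H.
module _ (G : Graph) (H : Subset (Graph.size G)) where
  open Graph G

  Adjacent : V → V → Set
  Adjacent u v = u ≢ v × ∃[ e ] (e ∈ H × u ∈ edge e × v ∈ edge e)

  Connected : Set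
  Connected = ∀ u v → Star Adjacent u v

  -- The cycle with successive, pairwise distinct, vertices v ∷ vs.
  IsCycle : V → List V → Set
  IsCycle v vs = 2 ≤ length vs × Unique (v ∷ vs) × Linked Adjacent (v ∷ vs ++ [ v ])

  Acyclic : Set
  Acyclic = ∀ v vs → ¬ IsCycle v vs

  IsSpanningTree : Set
  IsSpanningTree = Connected × Acyclic

  degree : V → ℕ
  degree v = ∣ Vec.tabulate (λ e → lookup (edge e) v) ∩ H ∣

record Digraph (n : ℕ) : Set where
  field
    arc      : Fin n → Fin n → Bool
    loopless : ∀ i → arc i i ≡ false

dep : ∀ {n} → Digraph n → Fin n → Subset n
dep D e = Vec.tabulate (λ e′ → Digraph.arc D e′ e)

Satisfies : ∀ {n} → Digraph n → (ℓ u : Fin n → ℕ) → Subset n → Set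
Satisfies D ℓ u H = ∀ e → e ∈ H → ℓ e ≤ ∣ dep D e ∩ H ∣ × ∣ dep D e ∩ H ∣ ≤ u e

bit : Bool → Symbol
bit false = 𝟎
bit true  = 𝟏

bits : List Bool → List Symbol
bits = map bit

-- Bijective base-2 numerals, least significant digit first: 𝟎 stands for the
-- digit 1 and 𝟏 for the digit 2, so that a number n takes ⌊log₂ (n + 1)⌋ symbols.
numeralᵇ : ℕᵇ → List Symbol
numeralᵇ zero     = []
numeralᵇ 1+[2 b ] = 𝟎 ∷ numeralᵇ b
numeralᵇ 2[1+ b ] = 𝟏 ∷ numeralᵇ b

numeral : ℕ → List Symbol
numeral n = numeralᵇ (fromℕ n)

section : ∀ {n} → (Fin n → List Symbol) → List Symbol
section row = concat (tabulate (λ i → row i ++ [ comma ])) ++ [ semi ]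

-- The order in unary, followed by the edge-vertex incidence matrix.
encodeGraph : Graph → List Symbol
encodeGraph G = replicate order 𝟏 ++ semi ∷ section (λ e → bits (toList (edge e)))
  where open Graph G

encodeDigraph : ∀ {n} → Digraph n → List Symbol
encodeDigraph D = section (λ i → bits (tabulate (Digraph.arc D i)))

record FmDSTInstance : Set where
  field
    G          : Graph
    C          : Subset (Graph.order G)
    ℓ          : ∀ {v} → v ∈ C → ℕ
    ℓ-positive : ∀ {v} (v∈C : v ∈ C) → 1 ≤ ℓ v∈C

  open Graph G public

  IsSolution : Subset size → Set
  IsSolution T = IsSpanningTree G T
    × (∀ {v} (v∈C : v ∈ C) → ℓ v∈C ≤ degree G T v)
    × (∀ {v} → v ∉ C → degree G T v ≡ 1)

  -- 𝟎 for a vertex outside C, 𝟏 followed by ℓ v for a vertex v of C.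
  label : V → List Symbol
  label v with v ∈? C
  ... | yes v∈C = 𝟏 ∷ numeral (ℓ v∈C)
  ... | no  _   = 𝟎 ∷ []

FmDST : DecisionProblem
FmDST = record
  { Instance = FmDSTInstance
  ; encode   = λ I → let open FmDSTInstance I in encodeGraph G ++ section label
  ; Yes      = λ I → let open FmDSTInstance I in ∃ IsSolution
  }

record GDCSTInstance : Set where
  field
    G   : Graph
    D   : Digraph (Graph.size G)
    ℓ u : Fin (Graph.size G) → ℕ

  IsSolution : Subset (Graph.size G) → Set
  IsSolution T = IsSpanningTree G T × Satisfies D ℓ u T

G-DCST : DecisionProblem
G-DCST = record
  { Instance = GDCSTInstance
  ; encode   = λ I → let open GDCSTInstance I in
      encodeGraph G ++ encodeDigraph D ++
      section (λ e → numeral (ℓ e)) ++ section (λ e → numeral (u e))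
  ; Yes      = λ I → let open GDCSTInstance I in ∃ IsSolution
  }

{-# OPTIONS --safe #-}
module Submission where

-- Attach a pendant edge to every vertex v. Spanning trees of the new graph consist of all pendant
-- edges and a spanning tree of G, so letting the pendant edge at v depend on the edges of G at v
-- turns the constraint on the degree of v into a constraint on its pendant edge; the other edges
-- depend on nothing. A multitape machine writes the new instance with a bounded number of passes
-- over its input, keeping the numbers n of vertices and m of edges in unary; each symbol of the
-- input costs it O(n + m) steps, so the total time is quadratic.

open import Data.Bool using (Bool; true; false)
open import Data.Empty using (⊥)
open import Data.Fin using (Fin; zero; suc; #_; _≟_; _↑ˡ_; _↑ʳ_; splitAt)
open import Data.Fin.Properties using (all?; splitAt-↑ˡ; splitAt-↑ʳ; splitAt⁻¹-↑ˡ; splitAt⁻¹-↑ʳ)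
open import Data.Fin.Subset using (Subset; _∈_; _∉_; _∩_; ∣_∣) renaming (⊤ to full; ⊥ to empty)
open import Data.Fin.Subset.Properties using (_∈?_; ∈⊤; ∉⊥; ∣⊥∣≡0; ∣p∣≤n)
open import Data.List
  using (List; []; _∷_; _++_; [_]; map; replicate; length; concat; concatMap; foldl; tabulate; _ʳ++_)
open import Data.List.Properties
open import Data.List.Relation.Unary.All as All using (All; []; _∷_)
import Data.List.Relation.Unary.All.Properties as Allₚ
open import Data.List.Relation.Unary.AllPairs using ([]; _∷_)
import Data.List.Relation.Unary.AllPairs.Properties as AllPairsₚ
open import Data.List.Relation.Unary.Linked as Linked using (Linked; [-]; _∷_)
import Data.List.Relation.Unary.Linked.Properties as Linkedₚ
import Data.List.Relation.Unary.Unique.Propositional.Properties as Uniqueₚ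
open import Data.Maybe using (Maybe; just; nothing)
open import Data.Nat using (ℕ; zero; suc; _+_; _*_; _^_; _≤_; z≤n; s≤s)
open import Data.Nat.Binary using (ℕᵇ; 1+[2_]; 2[1+_]; toℕ; fromℕ) renaming (zero to 0ᵇ)
open import Data.Nat.Binary.Properties using (fromℕ-toℕ)
open import Data.Nat.Properties hiding (_≟_)
open import Data.Nat.Tactic.RingSolver using (solve-∀)
open import Data.Product using (_×_; _,_; ∃; ∃-syntax; proj₁; proj₂)
open import Data.Sum using (_⊎_; inj₁; inj₂; [_,_]′)
open import Data.Unit using (tt)
open import Data.Vec as Vec using (Vec; []; _∷_; here; there; lookup; toList)
import Data.Vec.Properties as Vecₚ
open import Data.Vec.Properties.WithK using ([]=-irrelevant)
open import Function using (_∘_; const)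
open import Function.Bundles using (_⇔_; mk⇔; mk↔ₛ′)
open import Function.Definitions using (Injective)
open import Relation.Binary.Construct.Closure.ReflexiveTransitive as Star using (Star)
open import Relation.Binary.PropositionalEquality hiding ([_])
open import Relation.Nullary using (yes; no; contradiction)
open import Relation.Nullary.Decidable using (toWitness)
open import Tactic.MonoidSolver using (solve)
open import Defs

-- Spanning trees of a graph with pendant edges

-- `G-DCST` constrains an edge only when the edge is in the chosen tree, whereas a degree condition
-- on a vertex must always hold. A pendant edge lies in every spanning tree, so its constraint is
-- always in force; and as it depends on edges of `G` alone, it never counts itself, so the bounds
-- at `v` are those on its degree in `G`, without correction. The construction spares the machine
-- all binary arithmetic: the output is assembled from copied input symbols and from runs whose
-- lengths are held in unary. Arcs lead from an edge of `G` to the pendant edges at its ends, so its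
-- row of the arc matrix is its incidence row followed by zeros. The label `𝟎` of a vertex outside
-- `C` already is the numeral of 1. `FmDST` sets no upper bound on the degree of a vertex of `C`;
-- any number from `m` on would serve, and `2 ^ m ∸ 1` is taken because a run of `m` symbols denotes
-- it.

module _ (G : Graph) (H : Subset (Graph.size G)) where

  Adjacent-sym : ∀ {u v} → Adjacent G H u v → Adjacent G H v u
  Adjacent-sym (u≢v , e , e∈H , u∈e , v∈e) = u≢v ∘ sym , e , e∈H , v∈e , u∈e

  Linked-∷ʳ : ∀ {x y} xs → Linked (Adjacent G H) (xs ++ [ x ]) → Adjacent G H x y →
    Linked (Adjacent G H) ((xs ++ [ x ]) ++ [ y ])
  Linked-∷ʳ []           [-]      xy = xy ∷ [-]
  Linked-∷ʳ (_ ∷ [])     (r ∷ rs) xy = r ∷ Linked-∷ʳ [] rs xy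
  Linked-∷ʳ (_ ∷ w ∷ ws) (r ∷ rs) xy = r ∷ Linked-∷ʳ (w ∷ ws) rs xy

  -- `P` is carried along so that the predecessor of the closing vertex can be told apart from the
  -- successor of the starting vertex.
  Linked-last : ∀ {P : Graph.V G → Set} {x} y ys → All P (y ∷ ys) →
    Linked (Adjacent G H) (y ∷ ys ++ [ x ]) → ∃[ z ] P z × Adjacent G H z x
  Linked-last y []       (p ∷ [])     (r ∷ [-]) = y , p , r
  Linked-last y (w ∷ ws) (_ ∷ ps)     (_ ∷ rs)  = Linked-last w ws ps rs

  IsCycle-rotate : ∀ {v x xs} → IsCycle G H v (x ∷ xs) → IsCycle G H x (xs ++ [ v ])
  IsCycle-rotate {v} {x} {xs} (long , v∉ ∷ unique , r ∷ rs) =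
    subst (2 ≤_) (sym (trans (length-++ xs) (+-comm _ 1))) long ,
    AllPairsₚ.++⁺ unique ([] ∷ []) (All.map (λ v≢y → v≢y ∘ sym ∷ []) v∉) ,
    Linked-∷ʳ (x ∷ xs) rs r

  -- For keeping pendant vertices off cycles, as these have a single neighbour. The predecessor `z`
  -- of `v` comes after the successor `x` in a list without repetitions, hence differs from it.
  IsCycle-neighbours : ∀ {v vs} → IsCycle G H v vs →
    ∃[ x ] ∃[ z ] x ≢ z × Adjacent G H v x × Adjacent G H z v
  IsCycle-neighbours {vs = x ∷ []}     (s≤s () , _)
  IsCycle-neighbours {vs = x ∷ y ∷ ys} (_ , _ ∷ x∉ ∷ _ , r ∷ _ ∷ rs) with Linked-last y ys x∉ rs
  ... | z , x≢z , zv = x , z , x≢z , r , zv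

  -- Rotation makes each vertex the starting one in turn. The suffix `ys` is arbitrary because each
  -- rotation appends the former starting vertex to it.
  IsCycle-All : ∀ {P : Graph.V G → Set} → (∀ {v vs} → IsCycle G H v vs → P v) →
    ∀ xs {ys v} → IsCycle G H v (xs ++ ys) → All P xs
  IsCycle-All p []       c = []
  IsCycle-All p (x ∷ xs) {ys} {v} c = p c′ ∷ IsCycle-All p xs
    (subst (IsCycle G H x) (++-assoc xs ys [ v ]) c′)
    where c′ = IsCycle-rotate c

map-preimage : ∀ {A B : Set} {f : A → B} {ys} → All (λ y → ∃[ x ] y ≡ f x) ys → ∃[ xs ] ys ≡ map f xs
map-preimage []                = [] , refl
map-preimage ((x , refl) ∷ ps) with map-preimage ps
... | xs , refl = x ∷ xs , refl

-- Interleaving old and new vertices lets the machine double an incidence row bit by bit.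
twice : ∀ {n} → Subset n → Subset (n * 2)
twice []      = []
twice (b ∷ p) = b ∷ false ∷ twice p

ends : ∀ {n} → Fin n → Subset (n * 2)
ends zero    = true ∷ true ∷ empty
ends (suc v) = false ∷ false ∷ ends v

old new : ∀ {n} → Fin n → Fin (n * 2)
old zero    = zero
old (suc v) = suc (suc (old v))
new zero    = suc zero
new (suc v) = suc (suc (new v))

base : ∀ n → Fin (n * 2) → Fin n
base (suc n) zero          = zero
base (suc n) (suc zero)    = zero
base (suc n) (suc (suc x)) = suc (base n x)

base-old : ∀ {n} (v : Fin n) → base _ (old v) ≡ v
base-old zero    = refl
base-old (suc v) = cong suc (base-old v)

base-new : ∀ {n} (v : Fin n) → base _ (new v) ≡ v
base-new zero    = refl
base-new (suc v) = cong suc (base-new v)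

data OldOrNew n : Fin (n * 2) → Set where
  isOld : (v : Fin n) → OldOrNew n (old v)
  isNew : (v : Fin n) → OldOrNew n (new v)

oldOrNew : ∀ n (x : Fin (n * 2)) → OldOrNew n x
oldOrNew (suc n) zero       = isOld zero
oldOrNew (suc n) (suc zero) = isNew zero
oldOrNew (suc n) (suc (suc x)) with oldOrNew n x
... | isOld v = isOld (suc v)
... | isNew v = isNew (suc v)

old-injective : ∀ {n} {u v : Fin n} → old u ≡ old v → u ≡ v
old-injective {u = u} {v} eq = trans (sym (base-old u)) (trans (cong (base _) eq) (base-old v))

old≢new : ∀ {n} {u v : Fin n} → old u ≢ new v
old≢new {u = zero}  {zero}  ()
old≢new {u = zero}  {suc _} ()
old≢new {u = suc _} {zero}  ()
old≢new {u = suc u} {suc v} eq = old≢new (suc²-injective eq)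
  where
  suc²-injective : ∀ {k} {i j : Fin k} → suc (suc i) ≡ Fin.suc (suc j) → i ≡ j
  suc²-injective refl = refl

old∈twice⁺ : ∀ {n} {v : Fin n} {p : Subset n} → v ∈ p → old v ∈ twice p
old∈twice⁺ here        = here
old∈twice⁺ (there v∈p) = there (there (old∈twice⁺ v∈p))

old∈twice⁻ : ∀ {n} {v : Fin n} {p : Subset n} → old v ∈ twice p → v ∈ p
old∈twice⁻ {v = zero}  {true ∷ p} here                = here
old∈twice⁻ {v = suc v} {_ ∷ p}    (there (there v∈p)) = there (old∈twice⁻ v∈p)

new∉twice : ∀ {n} {v : Fin n} {p : Subset n} → new v ∉ twice p
new∉twice {v = zero}  {_ ∷ p} (there ())
new∉twice {v = suc v} {_ ∷ p} (there (there v∈p)) = new∉twice v∈p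

old∈ends : ∀ {n} (v : Fin n) → old v ∈ ends v
old∈ends zero    = here
old∈ends (suc v) = there (there (old∈ends v))

new∈ends : ∀ {n} (v : Fin n) → new v ∈ ends v
new∈ends zero    = there here
new∈ends (suc v) = there (there (new∈ends v))

∈ends⁻ : ∀ {n x} (v : Fin n) → x ∈ ends v → base n x ≡ v
∈ends⁻ zero    here               = refl
∈ends⁻ zero    (there here)       = refl
∈ends⁻ zero    (there (there x∈)) = contradiction x∈ ∉⊥
∈ends⁻ (suc v) (there (there x∈)) = cong suc (∈ends⁻ v x∈)

∣twice∣ : ∀ {n} (p : Subset n) → ∣ twice p ∣ ≡ ∣ p ∣
∣twice∣ []          = refl
∣twice∣ (true ∷ p)  = cong suc (∣twice∣ p)
∣twice∣ (false ∷ p) = ∣twice∣ p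

∣ends∣ : ∀ {n} (v : Fin n) → ∣ ends v ∣ ≡ 2
∣ends∣ {suc n} zero = cong (2 +_) (∣⊥∣≡0 (n * 2))
∣ends∣ (suc v)      = ∣ends∣ v

twice-injective : ∀ {n} {p q : Subset n} → twice p ≡ twice q → p ≡ q
twice-injective {p = []}    {[]}    _  = refl
twice-injective {p = b ∷ p} {c ∷ q} eq with cong Vec.head eq | cong (Vec.tail ∘ Vec.tail) eq
... | refl | eq′ = cong (b ∷_) (twice-injective eq′)

data Summand {n m} : Fin (n + m) → Set where
  inˡ : ∀ v → Summand (v ↑ˡ m)
  inʳ : ∀ e → Summand (n ↑ʳ e)

summand : ∀ n {m} (i : Fin (n + m)) → Summand {n} {m} i
summand n i with splitAt n i in eq
... | inj₁ v with refl ← splitAt⁻¹-↑ˡ {i = i} eq = inˡ v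
... | inj₂ e with refl ← splitAt⁻¹-↑ʳ {i = i} eq = inʳ e

module _ {n m} {P : Subset n} {T : Subset m} where

  ∈-++ˡ⁺ : ∀ {v} → v ∈ P → v ↑ˡ m ∈ P Vec.++ T
  ∈-++ˡ⁺ {v} v∈P = Vecₚ.lookup⇒[]= _ _ (trans (Vecₚ.lookup-++ˡ P T v) (Vecₚ.[]=⇒lookup v∈P))

  ∈-++ˡ⁻ : ∀ {v} → v ↑ˡ m ∈ P Vec.++ T → v ∈ P
  ∈-++ˡ⁻ {v} v∈ = Vecₚ.lookup⇒[]= _ _ (trans (sym (Vecₚ.lookup-++ˡ P T v)) (Vecₚ.[]=⇒lookup v∈))

  ∈-++ʳ⁺ : ∀ {e} → e ∈ T → n ↑ʳ e ∈ P Vec.++ T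
  ∈-++ʳ⁺ {e} e∈T = Vecₚ.lookup⇒[]= _ _ (trans (Vecₚ.lookup-++ʳ P T e) (Vecₚ.[]=⇒lookup e∈T))

  ∈-++ʳ⁻ : ∀ {e} → n ↑ʳ e ∈ P Vec.++ T → e ∈ T
  ∈-++ʳ⁻ {e} e∈ = Vecₚ.lookup⇒[]= _ _ (trans (sym (Vecₚ.lookup-++ʳ P T e)) (Vecₚ.[]=⇒lookup e∈))

module Pendant (G : Graph) where
  open Graph G renaming (order to n; size to m)

  edge⁺ : Fin (n + m) → Subset (n * 2)
  edge⁺ i = [ ends , twice ∘ edge ]′ (splitAt n i)

  edge⁺-pendant : ∀ v → edge⁺ (v ↑ˡ m) ≡ ends v
  edge⁺-pendant v rewrite splitAt-↑ˡ n v m = refl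

  edge⁺-edge : ∀ e → edge⁺ (n ↑ʳ e) ≡ twice (edge e)
  edge⁺-edge e rewrite splitAt-↑ʳ n m e = refl

  -- New vertices separate the cases: a pendant edge is determined by its new end, and a doubled
  -- edge of `G` has no new end.
  edge⁺-injective : Injective _≡_ _≡_ edge⁺
  edge⁺-injective {i} {j} eq with summand n i | summand n j
  ... | inˡ u | inˡ v rewrite edge⁺-pendant u | edge⁺-pendant v =
    cong (_↑ˡ m) (trans (sym (base-new u)) (∈ends⁻ v (subst (new u ∈_) eq (new∈ends u))))
  ... | inˡ u | inʳ e rewrite edge⁺-pendant u | edge⁺-edge e =
    contradiction (subst (new u ∈_) eq (new∈ends u)) new∉twice
  ... | inʳ e | inˡ v rewrite edge⁺-pendant v | edge⁺-edge e =
    contradiction (subst (new v ∈_) (sym eq) (new∈ends v)) new∉twice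
  ... | inʳ e | inʳ f rewrite edge⁺-edge e | edge⁺-edge f =
    cong (n ↑ʳ_) (simple (twice-injective eq))

  G⁺ : Graph
  G⁺ = record
    { order    = n * 2
    ; size     = n + m
    ; nonempty = m*n≢0 n 2 {{nonempty}}
    ; edge     = edge⁺
    ; two-ends = two
    ; simple   = edge⁺-injective
    }
    where
    two : ∀ i → ∣ edge⁺ i ∣ ≡ 2
    two i with summand n i
    ... | inˡ v rewrite edge⁺-pendant v = ∣ends∣ v
    ... | inʳ e rewrite edge⁺-edge e = trans (∣twice∣ (edge e)) (two-ends e)

  module _ {P : Subset n} {T : Subset m} where

    adjacent⁺ : ∀ {u v} → Adjacent G T u v → Adjacent G⁺ (P Vec.++ T) (old u) (old v)
    adjacent⁺ (u≢v , e , e∈T , u∈e , v∈e) =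
      u≢v ∘ old-injective , n ↑ʳ e , ∈-++ʳ⁺ e∈T ,
      subst (old _ ∈_) (sym (edge⁺-edge e)) (old∈twice⁺ u∈e) ,
      subst (old _ ∈_) (sym (edge⁺-edge e)) (old∈twice⁺ v∈e)

    adjacent⁻ : ∀ {u v} → Adjacent G⁺ (P Vec.++ T) (old u) (old v) → Adjacent G T u v
    adjacent⁻ {u} {v} (u≢v , i , i∈ , u∈ , v∈) with summand n i
    ... | inˡ w rewrite edge⁺-pendant w = contradiction (cong old
      (trans (trans (sym (base-old u)) (∈ends⁻ w u∈)) (trans (sym (∈ends⁻ w v∈)) (base-old v)))) u≢v
    ... | inʳ e rewrite edge⁺-edge e =
      u≢v ∘ cong old , e , ∈-++ʳ⁻ {P = P} i∈ , old∈twice⁻ u∈ , old∈twice⁻ v∈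

    -- A new vertex lies on no edge but its pendant one, so any adjacency at all shows that this
    -- edge was chosen.
    new-adjacent : ∀ {v x} → Adjacent G⁺ (P Vec.++ T) (new v) x → x ≡ old v × v ∈ P
    new-adjacent {v} {x} (v≢x , i , i∈ , v∈ , x∈) with summand n i
    ... | inʳ e rewrite edge⁺-edge e = contradiction v∈ new∉twice
    ... | inˡ w rewrite edge⁺-pendant w with oldOrNew n x | ∈ends⁻ w v∈ | ∈ends⁻ w x∈
    ...   | isOld u | refl | eq = cong old (trans (sym (base-old u)) (trans eq (base-new v))) ,
                                  subst (_∈ P) (base-new v) (∈-++ˡ⁻ {T = T} i∈)
    ...   | isNew u | refl | eq =
      contradiction (cong new (trans (trans (sym (base-new v)) (sym eq)) (base-new u))) v≢x

    -- `base` contracts the pendant edges: a step along one of them becomes the empty walk, any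
    -- other step an edge of `T`.
    walk⁻ : ∀ {x y} → Adjacent G⁺ (P Vec.++ T) x y → Star (Adjacent G T) (base n x) (base n y)
    walk⁻ {x} {y} xy with oldOrNew n x | oldOrNew n y
    ... | isOld u | isOld v rewrite base-old u | base-old v = adjacent⁻ xy Star.◅ Star.ε
    ... | isNew u | _ with refl ← proj₁ (new-adjacent xy) rewrite base-new u | base-old u = Star.ε
    ... | isOld u | isNew v with refl ← old-injective (proj₁ (new-adjacent ((Adjacent-sym G⁺ (P Vec.++ T)) xy)))
      rewrite base-old u | base-new u = Star.ε

    spanningTree⁻ : IsSpanningTree G⁺ (P Vec.++ T) → IsSpanningTree G T
    spanningTree⁻ (connected , acyclic) =
      (λ u v → subst₂ (Star _) (base-old u) (base-old v)
        (Star.kleisliStar (base n) walk⁻ (connected (old u) (old v)))) ,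
      λ v vs (long , unique , linked) → acyclic (old v) (map old vs)
        ( subst (2 ≤_) (sym (length-map old vs)) long
        , Uniqueₚ.map⁺ old-injective unique
        , subst (Linked _) (map-++ old (v ∷ vs) [ v ]) (Linkedₚ.map⁺ (Linked.map adjacent⁺ linked)) )

    -- As `new v` and `old v` differ, a walk between them has a first step, which can only use the
    -- pendant edge at `v`.
    pendant-forced : Connected G⁺ (P Vec.++ T) → ∀ v → v ∈ P
    pendant-forced connected v = first (connected (new v) (old v)) refl
      where
      first : ∀ {x} → Star (Adjacent G⁺ (P Vec.++ T)) (new v) x → x ≡ old v → v ∈ P
      first Star.ε        eq = contradiction (sym eq) old≢new
      first (r Star.◅ rs) _  = proj₂ (new-adjacent r)

  module _ {T : Subset m} where

    private
      T⁺ : Subset (n + m)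
      T⁺ = full Vec.++ T

    pendant-adjacent : ∀ v → Adjacent G⁺ T⁺ (old v) (new v)
    pendant-adjacent v = old≢new , v ↑ˡ m , ∈-++ˡ⁺ ∈⊤ ,
      subst (old v ∈_) (sym (edge⁺-pendant v)) (old∈ends v) ,
      subst (new v ∈_) (sym (edge⁺-pendant v)) (new∈ends v)

    cycle-old : ∀ {x xs} → IsCycle G⁺ T⁺ x xs → ∃[ v ] x ≡ old v
    cycle-old {x} c with oldOrNew n x
    ... | isOld v = v , refl
    ... | isNew v with IsCycle-neighbours G⁺ T⁺ c
    ...   | y , z , y≢z , vy , zv = contradiction
      (trans (proj₁ (new-adjacent {P = full} {T} vy))
        (sym (proj₁ (new-adjacent {P = full} {T} (Adjacent-sym G⁺ T⁺ zv))))) y≢z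

    -- Walks are routed through the old vertices. By `cycle-old` every vertex of a cycle is old, so
    -- the cycle is the image of one in `T`.
    spanningTree⁺ : IsSpanningTree G T → IsSpanningTree G⁺ T⁺
    spanningTree⁺ (connected , acyclic) = connected⁺ , acyclic⁺
      where
      toOld : ∀ x → Star (Adjacent G⁺ T⁺) x (old (base n x))
      toOld x with oldOrNew n x
      ... | isOld v rewrite base-old v = Star.ε
      ... | isNew v rewrite base-new v = Adjacent-sym G⁺ T⁺ (pendant-adjacent v) Star.◅ Star.ε
      connected⁺ : Connected G⁺ T⁺
      connected⁺ x y = toOld x Star.◅◅ Star.gmap old adjacent⁺ (connected (base n x) (base n y))
        Star.◅◅ Star.reverse (Adjacent-sym G⁺ T⁺) (toOld y)
      acyclic⁺ : Acyclic G⁺ T⁺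
      acyclic⁺ x xs c@(long , unique , linked)
        with cycle-old c
           | map-preimage (IsCycle-All G⁺ T⁺ cycle-old xs (subst (IsCycle G⁺ T⁺ x) (sym (++-identityʳ xs)) c))
      ... | v , refl | vs , refl = acyclic v vs
        ( subst (2 ≤_) (length-map old vs) long
        , Uniqueₚ.map⁻ unique
        , Linked.map (adjacent⁻ {P = full}) (Linkedₚ.map⁻ (subst (Linked _) (sym (map-++ old (v ∷ vs) [ v ])) linked)) )

-- The machine

data Phase : Set where
  start readOrder copyOrder pendantRow beforeEnds betweenEnds
    afterEnds rewindMarks edgeRow padBit rewindEdges pendantArcs
    pendantZeros rewindZeros edgeArcs edgeZeros rewindEdgeZeros lower
    lowerNumeral lowerCommas rewindCommas rewindLabels upper upperNumeral
    rewindNumeral skipLabel upperCommas finished : Phase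

phases : Vec Phase 28
phases =
  start ∷ readOrder ∷ copyOrder ∷ pendantRow ∷ beforeEnds ∷ betweenEnds ∷
  afterEnds ∷ rewindMarks ∷ edgeRow ∷ padBit ∷ rewindEdges ∷ pendantArcs ∷
  pendantZeros ∷ rewindZeros ∷ edgeArcs ∷ edgeZeros ∷ rewindEdgeZeros ∷ lower ∷
  lowerNumeral ∷ lowerCommas ∷ rewindCommas ∷ rewindLabels ∷ upper ∷ upperNumeral ∷
  rewindNumeral ∷ skipLabel ∷ upperCommas ∷ finished ∷ []

index : Phase → Fin 28
index start           = # 0
index readOrder       = # 1
index copyOrder       = # 2
index pendantRow      = # 3
index beforeEnds      = # 4
index betweenEnds     = # 5
index afterEnds       = # 6
index rewindMarks     = # 7
index edgeRow         = # 8
index padBit          = # 9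
index rewindEdges     = # 10
index pendantArcs     = # 11
index pendantZeros    = # 12
index rewindZeros     = # 13
index edgeArcs        = # 14
index edgeZeros       = # 15
index rewindEdgeZeros = # 16
index lower           = # 17
index lowerNumeral    = # 18
index lowerCommas     = # 19
index rewindCommas    = # 20
index rewindLabels    = # 21
index upper           = # 22
index upperNumeral    = # 23
index rewindNumeral   = # 24
index skipLabel       = # 25
index upperCommas     = # 26
index finished        = # 27

phase-finite : Finite Phase
phase-finite = 28 , mk↔ₛ′ index (Vec.lookup phases)
  (toWitness {a? = all? λ i → index (Vec.lookup phases i) ≟ i} tt) lookup-index
  where
  lookup-index : ∀ q → Vec.lookup phases (index q) ≡ q
  lookup-index start           = refl
  lookup-index readOrder       = refl
  lookup-index copyOrder       = refl
  lookup-index pendantRow      = refl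
  lookup-index beforeEnds      = refl
  lookup-index betweenEnds     = refl
  lookup-index afterEnds       = refl
  lookup-index rewindMarks     = refl
  lookup-index edgeRow         = refl
  lookup-index padBit          = refl
  lookup-index rewindEdges     = refl
  lookup-index pendantArcs     = refl
  lookup-index pendantZeros    = refl
  lookup-index rewindZeros     = refl
  lookup-index edgeArcs        = refl
  lookup-index edgeZeros       = refl
  lookup-index rewindEdgeZeros = refl
  lookup-index lower           = refl
  lookup-index lowerNumeral    = refl
  lookup-index lowerCommas     = refl
  lookup-index rewindCommas    = refl
  lookup-index rewindLabels    = refl
  lookup-index upper           = refl
  lookup-index upperNumeral    = refl
  lookup-index rewindNumeral   = refl
  lookup-index skipLabel       = refl
  lookup-index upperCommas     = refl
  lookup-index finished        = refl

Glyph : Set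
Glyph = Maybe (Symbol ⊎ ⊥)

pattern glyph s = just (inj₁ s)

infix 9 _◂ _• _▸
_◂ _• _▸ : Glyph → Glyph × Move
c ◂ = c , left
c • = c , stay
c ▸ = c , right

infix 4 _⟨_,_,_,_,_,_⟩
_⟨_,_,_,_,_,_⟩ : Phase → (i o a p b k : Glyph × Move) → Maybe (Phase × Vec (Glyph × Move) 6)
q ⟨ i , o , a , p , b , k ⟩ = just (q , i ∷ o ∷ a ∷ p ∷ b ∷ k ∷ [])

-- Besides input i and output o there are four tapes with unary numbers: a of length
-- 2n (whose cells are turned from 𝟎 to 𝟏 as the ends of pendant edges are used up),
-- p of length n, b of length m and k of length m + n.
rule : Phase → (i o a p b k : Glyph) → Maybe (Phase × Vec (Glyph × Move) 6)
-- Each counter leaves a blank cell behind, which later stops the sweeps to the left.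
rule start i o a p b k = readOrder ⟨ i • , o • , a ▸ , p ▸ , b ▸ , k ▸ ⟩

rule readOrder (glyph 𝟏)    o a p b k = copyOrder ⟨ glyph 𝟏 • , glyph 𝟏 ▸ , glyph 𝟎 ▸ , p • , b • , k • ⟩
rule readOrder (glyph semi) o a p b k = pendantRow ⟨ glyph semi ▸ , glyph semi ▸ , a • , p ◂ , b • , k • ⟩
rule copyOrder i o a p b k = readOrder ⟨ i ▸ , glyph 𝟏 ▸ , glyph 𝟎 ▸ , glyph 𝟏 ▸ , b • , glyph 𝟏 ▸ ⟩

-- `p` is crossed leftwards here and rightwards in `pendantArcs`, so it counts to n twice without
-- being rewound.
rule pendantRow i o a (glyph s) b k = beforeEnds ⟨ i • , o • , a ◂ , glyph s ◂ , b • , k • ⟩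
rule pendantRow i o a nothing   b k = edgeRow ⟨ i • , o • , a • , nothing • , b • , k • ⟩
-- The cells already turned to `𝟏` are met first. Each row turns two more, which moves its pair of
-- ones two places to the right.
rule beforeEnds  i o (glyph 𝟏) p b k = beforeEnds ⟨ i • , glyph 𝟎 ▸ , glyph 𝟏 ◂ , p • , b • , k • ⟩
rule beforeEnds  i o (glyph 𝟎) p b k = betweenEnds ⟨ i • , glyph 𝟏 ▸ , glyph 𝟏 ◂ , p • , b • , k • ⟩
rule betweenEnds i o a         p b k = afterEnds ⟨ i • , glyph 𝟏 ▸ , glyph 𝟏 ◂ , p • , b • , k • ⟩
rule afterEnds   i o (glyph s) p b k = afterEnds ⟨ i • , glyph 𝟎 ▸ , glyph s ◂ , p • , b • , k • ⟩
rule afterEnds   i o nothing   p b k = rewindMarks ⟨ i • , glyph comma ▸ , nothing ▸ , p • , b • , k • ⟩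
rule rewindMarks i o (glyph s) p b k = rewindMarks ⟨ i • , o • , glyph s ▸ , p • , b • , k • ⟩
rule rewindMarks i o nothing   p b k = pendantRow ⟨ i • , o • , nothing • , p • , b • , k • ⟩

rule edgeRow (glyph semi)  o a p b k = rewindEdges ⟨ glyph semi ◂ , glyph semi ▸ , a • , p • , b • , k • ⟩
-- The number of edges is nowhere written in the input; the commas that end the rows are counted
-- instead, on `b` and on top of the n marks of `k`.
rule edgeRow (glyph comma) o a p b k = edgeRow ⟨ glyph comma ▸ , glyph comma ▸ , a • , p • , glyph 𝟏 ▸ , glyph 𝟏 ▸ ⟩
rule edgeRow (glyph s)     o a p b k = padBit ⟨ glyph s • , glyph s ▸ , a • , p • , b • , k • ⟩
rule padBit i o a p b k = edgeRow ⟨ i ▸ , glyph 𝟎 ▸ , a • , p • , b • , k • ⟩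
rule rewindEdges (glyph semi) o a p b k = pendantArcs ⟨ glyph semi ▸ , o • , a • , p ▸ , b • , k • ⟩
rule rewindEdges (glyph s)    o a p b k = rewindEdges ⟨ glyph s ◂ , o • , a • , p • , b • , k • ⟩

rule pendantArcs  i o a (glyph s) b k = pendantZeros ⟨ i • , o • , a • , glyph s • , b • , k ◂ ⟩
rule pendantArcs  i o a nothing   b k = edgeArcs ⟨ i • , o • , a • , nothing • , b • , k • ⟩
rule pendantZeros i o a p b (glyph s) = pendantZeros ⟨ i • , glyph 𝟎 ▸ , a • , p • , b • , glyph s ◂ ⟩
rule pendantZeros i o a p b nothing   = rewindZeros ⟨ i • , glyph comma ▸ , a • , p • , b • , nothing ▸ ⟩
rule rewindZeros  i o a p b (glyph s) = rewindZeros ⟨ i • , o • , a • , p • , b • , glyph s ▸ ⟩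
rule rewindZeros  i o a p b nothing   = pendantArcs ⟨ i • , o • , a • , p ▸ , b • , nothing • ⟩

rule edgeArcs (glyph semi)  o a p b k = lower ⟨ glyph semi ▸ , glyph semi ▸ , a • , p • , b • , k • ⟩
rule edgeArcs (glyph comma) o a p b k = edgeZeros ⟨ glyph comma ▸ , o • , a • , p • , b ◂ , k • ⟩
rule edgeArcs (glyph s)     o a p b k = edgeArcs ⟨ glyph s ▸ , glyph s ▸ , a • , p • , b • , k • ⟩
rule edgeZeros       i o a p (glyph s) k = edgeZeros ⟨ i • , glyph 𝟎 ▸ , a • , p • , glyph s ◂ , k • ⟩
rule edgeZeros       i o a p nothing   k = rewindEdgeZeros ⟨ i • , glyph comma ▸ , a • , p • , nothing ▸ , k • ⟩
rule rewindEdgeZeros i o a p (glyph s) k = rewindEdgeZeros ⟨ i • , o • , a • , p • , glyph s ▸ , k • ⟩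
rule rewindEdgeZeros i o a p nothing   k = edgeArcs ⟨ i • , o • , a • , p • , nothing • , k • ⟩

-- The label `𝟎` is copied unchanged: in bijective base 2 it is the numeral of 1, the bound wanted
-- outside `C`.
rule lower (glyph 𝟎)    o a p b k = lowerNumeral ⟨ glyph 𝟎 ▸ , glyph 𝟎 ▸ , a • , p • , b • , k • ⟩
rule lower (glyph 𝟏)    o a p b k = lowerNumeral ⟨ glyph 𝟏 ▸ , o • , a • , p • , b • , k • ⟩
rule lower (glyph semi) o a p b k = lowerCommas ⟨ glyph semi • , o • , a • , p • , b ◂ , k • ⟩
rule lowerNumeral (glyph comma) o a p b k = lower ⟨ glyph comma ▸ , glyph comma ▸ , a • , p • , b • , k • ⟩
rule lowerNumeral (glyph s)     o a p b k = lowerNumeral ⟨ glyph s ▸ , glyph s ▸ , a • , p • , b • , k • ⟩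
-- An edge of `G` gets the bound 0, whose numeral is empty, so only its comma is written.
rule lowerCommas  i o a p (glyph s) k = lowerCommas ⟨ i • , glyph comma ▸ , a • , p • , glyph s ◂ , k • ⟩
rule lowerCommas  i o a p nothing   k = rewindCommas ⟨ i • , glyph semi ▸ , a • , p • , nothing ▸ , k • ⟩
rule rewindCommas i o a p (glyph s) k = rewindCommas ⟨ i • , o • , a • , p • , glyph s ▸ , k • ⟩
-- The input head rests on the closing `semi` and has to step off it before searching for the
-- previous one.
rule rewindCommas i o a p nothing   k = rewindLabels ⟨ i ◂ , o • , a • , p • , nothing • , k • ⟩
rule rewindLabels (glyph semi) o a p b k = upper ⟨ glyph semi ▸ , o • , a • , p • , b • , k • ⟩
rule rewindLabels (glyph s)    o a p b k = rewindLabels ⟨ glyph s ◂ , o • , a • , p • , b • , k • ⟩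

rule upper (glyph 𝟎)    o a p b k = skipLabel ⟨ glyph 𝟎 ▸ , glyph 𝟎 ▸ , a • , p • , b • , k • ⟩
rule upper (glyph 𝟏)    o a p b k = upperNumeral ⟨ glyph 𝟏 ▸ , o • , a • , p • , b ◂ , k • ⟩
rule upper (glyph semi) o a p b k = upperCommas ⟨ glyph semi • , o • , a • , p • , b ◂ , k • ⟩
rule upperNumeral  i o a p (glyph s) k = upperNumeral ⟨ i • , glyph 𝟎 ▸ , a • , p • , glyph s ◂ , k • ⟩
rule upperNumeral  i o a p nothing   k = rewindNumeral ⟨ i • , o • , a • , p • , nothing ▸ , k • ⟩
rule rewindNumeral i o a p (glyph s) k = rewindNumeral ⟨ i • , o • , a • , p • , glyph s ▸ , k • ⟩
rule rewindNumeral i o a p nothing   k = skipLabel ⟨ i • , o • , a • , p • , nothing • , k • ⟩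
rule skipLabel (glyph comma) o a p b k = upper ⟨ glyph comma ▸ , glyph comma ▸ , a • , p • , b • , k • ⟩
rule skipLabel (glyph s)     o a p b k = skipLabel ⟨ glyph s ▸ , o • , a • , p • , b • , k • ⟩
rule upperCommas i o a p (glyph s) k = upperCommas ⟨ i • , glyph comma ▸ , a • , p • , glyph s ◂ , k • ⟩
rule upperCommas i o a p nothing   k = finished ⟨ i • , glyph semi ▸ , a • , p • , nothing • , k • ⟩

rule _ _ _ _ _ _ _ = nothing

reduction : Machine
reduction = record
  { work         = 4
  ; State        = Phase
  ; Aux          = ⊥
  ; state-finite = phase-finite
  ; aux-finite   = 0 , mk↔ₛ′ (λ ()) (λ ()) (λ ()) (λ ())
  ; start        = start
  ; δ            = λ { q (i ∷ o ∷ a ∷ p ∷ b ∷ k ∷ []) → rule q i o a p b k }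
  }

-- Runs with a bounded number of steps

Configuration : Set
Configuration = Config reduction

glyphs : List Symbol → List Glyph
glyphs = map (λ s → glyph s)

focusʳ focusˡ : List Glyph → List Glyph → Tape Glyph
focusʳ ls []       = tape ls nothing []
focusʳ ls (c ∷ rs) = tape ls c rs
focusˡ []       rs = tape [] nothing rs
focusˡ (c ∷ ls) rs = tape ls c rs

shift : Glyph × Move → Tape Glyph → Tape Glyph
shift (c , left)  (tape ls _ rs) = focusˡ ls (c ∷ rs)
shift (c , stay)  (tape ls _ rs) = tape ls c rs
shift (c , right) (tape ls _ rs) = focusʳ (c ∷ ls) rs

act≡shift : ∀ a t → act reduction a t ≡ shift a t
act≡shift (c , left)  (tape []      _ rs) = refl
act≡shift (c , left)  (tape (_ ∷ _) _ rs) = refl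
act≡shift (c , stay)  (tape ls _ rs)      = refl
act≡shift (c , right) (tape ls _ [])      = refl
act≡shift (c , right) (tape ls _ (_ ∷ _)) = refl

zipWith-act : ∀ {n} (as : Vec (Glyph × Move) n) ts →
  Vec.zipWith (act reduction) as ts ≡ Vec.zipWith shift as ts
zipWith-act []       []       = refl
zipWith-act (a ∷ as) (t ∷ ts) = cong₂ _∷_ (act≡shift a t) (zipWith-act as ts)

-- `step` with `shift` for `act`, so that moves onto a list of unknown shape compute.
advance : Configuration → Maybe Configuration
advance (q , ts) with Machine.δ reduction q (Vec.map Tape.here ts)
... | nothing        = nothing
... | just (q′ , as) = just (q′ , Vec.zipWith shift as ts)

step≡advance : ∀ c → step reduction c ≡ advance c
step≡advance (q , ts) with Machine.δ reduction q (Vec.map Tape.here ts)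
... | nothing        = refl
... | just (q′ , as) = cong (λ ts′ → just (q′ , ts′)) (zipWith-act as ts)

infix  4 _⟶[_]_
infixr 5 _◅_ _◅◅_
infixl 4 _▻_

-- The number of steps is only bounded by the index.
data _⟶[_]_ : Configuration → ℕ → Configuration → Set where
  done : ∀ {c t} → c ⟶[ t ] c
  _◅_  : ∀ {c c′ c″ t} → advance c ≡ just c′ → c′ ⟶[ t ] c″ → c ⟶[ suc t ] c″

weaken : ∀ {c c′ s t} → s ≤ t → c ⟶[ s ] c′ → c ⟶[ t ] c′
weaken s≤t       done     = done
weaken (s≤s s≤t) (e ◅ es) = e ◅ weaken s≤t es

_◅◅_ : ∀ {c c′ c″ s t} → c ⟶[ s ] c′ → c′ ⟶[ t ] c″ → c ⟶[ s + t ] c″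
_◅◅_ {s = s} {t} done fs = weaken (m≤n+m t s) fs
(e ◅ es) ◅◅ fs = e ◅ (es ◅◅ fs)

_▻_ : ∀ {c c′ c″ t} → c ⟶[ t ] c′ → c′ ≡ c″ → c ⟶[ t ] c″
es ▻ refl = es

halts : ∀ {c c′ t} → c ⟶[ t ] c′ → advance c′ ≡ nothing →
  ∃[ s ] s ≤ t × _⇓[_]_ reduction c s c′
halts {c} done stop = 0 , z≤n , halt (trans (step≡advance c) stop)
halts {c} (e ◅ es) stop with halts es stop
... | s , s≤t , r = suc s , s≤s s≤t , next (trans (step≡advance c) e) r

infix 5 ⟪_∣_,_,_,_,_,_⟫
⟪_∣_,_,_,_,_,_⟫ : Phase → (i o a p b k : Tape Glyph) → Configuration
⟪ q ∣ i , o , a , p , b , k ⟫ = q , i ∷ o ∷ a ∷ p ∷ b ∷ k ∷ []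

out : List Glyph → Tape Glyph
out os = tape os nothing []

-- Cells left of a head are listed nearest first, so a written word is prepended in reverse. The
-- same function describes the part of the input already read.
emit : List Symbol → List Glyph → List Glyph
emit w os = glyphs w ʳ++ os

emit-++ : ∀ v w os → emit (v ++ w) os ≡ emit w (emit v os)
emit-++ v w os = trans (cong (_ʳ++ os) (map-++ _ v w)) (++-ʳ++ (glyphs v))

glyphs-++ : ∀ v w cs → glyphs (v ++ w) ++ cs ≡ glyphs v ++ glyphs w ++ cs
glyphs-++ v w cs = trans (cong (_++ cs) (map-++ _ v w)) (++-assoc (glyphs v) (glyphs w) cs)

marks : Symbol → ℕ → List Glyph
marks s n = replicate n (glyph s)

marks-∷ : ∀ s n cs → marks s n ++ glyph s ∷ cs ≡ marks s (suc n) ++ cs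
marks-∷ s zero    cs = refl
marks-∷ s (suc n) cs = cong (glyph s ∷_) (marks-∷ s n cs)

-- The resting position of a counter, with the head just after the marks. The listed blank is the
-- one left behind by the phase `start`.
unary : Symbol → ℕ → Tape Glyph
unary s n = tape (marks s n ++ nothing ∷ []) nothing []

-- Loop schemes for sweeps and scans of one tape

module _ (F : Tape Glyph → List Glyph → Configuration) (s z : Symbol)
  (move : ∀ ls rs os → F (tape ls (glyph s) rs) os ⟶[ 1 ] F (focusˡ ls (glyph s ∷ rs)) (glyph z ∷ os))
  where

  -- `F` is a configuration as a function of the swept tape and the output, so that one induction
  -- serves many phases; `move` is then a single transition that holds by computation.
  sweepˡ : ∀ n ls rs os →
    F (focusˡ (marks s n ++ ls) rs) os ⟶[ n ] F (focusˡ ls (marks s n ++ rs)) (emit (replicate n z) os)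
  sweepˡ zero    ls rs os = done
  sweepˡ (suc n) ls rs os =
    (move _ _ _ ◅◅ sweepˡ n ls (glyph s ∷ rs) (glyph z ∷ os))
    ▻ cong (λ rs′ → F (focusˡ ls rs′) (emit (replicate (suc n) z) os)) (marks-∷ s n rs)

module _ (F : Tape Glyph → List Glyph → Configuration) (s : Symbol) (w : List Symbol) (D : ℕ)
  (move : ∀ ls rs os → F (tape ls (glyph s) rs) os ⟶[ D ] F (focusʳ (glyph s ∷ ls) rs) (emit w os))
  where

  -- A mark may cost `D` steps because `runPendantArcs` runs an inner loop at each mark.
  sweepʳ : ∀ n ls rs os →
    F (focusʳ ls (marks s n ++ rs)) os ⟶[ n * D ]
    F (focusʳ (marks s n ++ ls) rs) (emit (concat (replicate n w)) os)
  sweepʳ zero    ls rs os = done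
  sweepʳ (suc n) ls rs os =
    (move _ _ _ ◅◅ sweepʳ n (glyph s ∷ ls) rs (emit w os))
    ▻ cong₂ (λ ls′ os′ → F (focusʳ ls′ rs) os′) (marks-∷ s n ls) (sym (emit-++ w _ os))

module _ (F : Tape Glyph → Configuration) (s : Symbol)
  (move : ∀ ls rs → F (tape ls (glyph s) rs) ⟶[ 1 ] F (focusʳ (glyph s ∷ ls) rs))
  where

  returnʳ : ∀ n ls rs → F (focusʳ ls (marks s n ++ rs)) ⟶[ n ] F (focusʳ (marks s n ++ ls) rs)
  returnʳ zero    ls rs = done
  returnʳ (suc n) ls rs =
    (move _ _ ◅◅ returnʳ n (glyph s ∷ ls) rs)
    ▻ cong (λ ls′ → F (focusʳ ls′ rs)) (marks-∷ s n ls)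

module _ (F G : Tape Glyph → List Glyph → Configuration) (s z : Symbol) (w : List Symbol)
  (forth : ∀ ls rs os → F (tape ls (glyph s) rs) os ⟶[ 1 ] F (focusˡ ls (glyph s ∷ rs)) (glyph z ∷ os))
  (turn : ∀ rs os → F (tape [] nothing rs) os ⟶[ 1 ] G (focusʳ (nothing ∷ []) rs) (emit w os))
  (back : ∀ ls rs os → G (tape ls (glyph s) rs) os ⟶[ 1 ] G (focusʳ (glyph s ∷ ls) rs) os)
  where

  -- Writes a block whose length is held on a counter and brings the counter back to rest for its
  -- next use; `w` is what the turning step adds, such as the comma that ends the block.
  roundTrip : ∀ n os →
    F (focusˡ (marks s n ++ nothing ∷ []) (nothing ∷ [])) os ⟶[ n * 2 + 1 ]
    G (unary s n) (emit (replicate n z ++ w) os)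
  roundTrip n os rewrite emit-++ (replicate n z) w os = weaken (≤-reflexive (budget n))
    (sweepˡ F s z forth n _ _ os
     ◅◅ turn _ _
     ◅◅ returnʳ (λ t → G t (emit w (emit (replicate n z) os))) s (λ ls rs → back ls rs _) n _ _)
    where
    budget : ∀ n → n + suc n ≡ n * 2 + 1
    budget = solve-∀

module _ (F : Tape Glyph → Configuration) {ok : Symbol → Set}
  (move : ∀ {s} → ok s → ∀ ls rs → F (tape ls (glyph s) rs) ⟶[ 1 ] F (focusˡ ls (glyph s ∷ rs)))
  where

  -- The head meets `w` from its right end, so the first symbol is crossed last. The predicate `ok`
  -- keeps out the delimiter at which the search stops.
  returnˡ : ∀ {w} → All ok w → ∀ ls rs →
    F (focusˡ (emit w ls) rs) ⟶[ length w ] F (focusˡ ls (glyphs w ++ rs))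
  returnˡ         []       ls rs = done
  returnˡ {s ∷ w} (p ∷ ps) ls rs =
    weaken (≤-reflexive (+-comm (length w) 1)) (returnˡ ps (glyph s ∷ ls) rs ◅◅ move p _ _)

module _ (F : Tape Glyph → List Glyph → Configuration) (g : Bool → List Symbol) (D : ℕ)
  (move : ∀ b ls rs os →
    F (tape ls (glyph (bit b)) rs) os ⟶[ D ] F (focusʳ (glyph (bit b) ∷ ls) rs) (emit (g b) os))
  where

  scanBits : ∀ bs ls rs os →
    F (focusʳ ls (glyphs (bits bs) ++ rs)) os ⟶[ length bs * D ]
    F (focusʳ (emit (bits bs) ls) rs) (emit (concatMap g bs) os)
  scanBits []       ls rs os = done
  scanBits (b ∷ bs) ls rs os =
    (move b _ _ _ ◅◅ scanBits bs (glyph (bit b) ∷ ls) rs (emit (g b) os))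
    ▻ cong (F (focusʳ (emit (bits (b ∷ bs)) ls) rs)) (sym (emit-++ (g b) _ os))

-- The index of F counts the items read; the running time is charged to the symbols read.
module _ {A : Set} (F : ℕ → Tape Glyph → List Glyph → Configuration)
  (item image : A → List Symbol) (D : ℕ)
  (body : ∀ x j ls rs os →
    F j (focusʳ ls (glyphs (item x) ++ rs)) os ⟶[ length (item x) * D ]
    F (suc j) (focusʳ (emit (item x) ls) rs) (emit (image x) os))
  where

  scanItems : ∀ xs j ls rs os →
    F j (focusʳ ls (glyphs (concatMap item xs) ++ rs)) os ⟶[ length (concatMap item xs) * D ]
    F (length xs + j) (focusʳ (emit (concatMap item xs) ls) rs) (emit (concatMap image xs) os)
  scanItems []       j ls rs os = done
  scanItems (x ∷ xs) j ls rs os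
    rewrite emit-++ (item x) (concatMap item xs) ls
          | emit-++ (image x) (concatMap image xs) os
          | glyphs-++ (item x) (concatMap item xs) rs
          | length-++ (item x) {concatMap item xs}
          | *-distribʳ-+ D (length (item x)) (length (concatMap item xs))
          | sym (+-suc (length xs) j)
    = body x j _ _ _ ◅◅ scanItems xs (suc j) _ rs _

-- The passes of the machine

runOrder : ∀ n j {l b} ls rs os → suc n + j ≡ l →
  ⟪ readOrder ∣ tape ls (glyph 𝟏) (marks 𝟏 n ++ glyph semi ∷ rs)
    , out os , unary 𝟎 (j * 2) , unary 𝟏 j , b , unary 𝟏 j ⟫
  ⟶[ suc n * 2 + 1 ]
  ⟪ pendantRow ∣ focusʳ (glyph semi ∷ marks 𝟏 (suc n) ++ ls) rs
    , out (emit (replicate (suc n * 2) 𝟏 ++ [ semi ]) os) , unary 𝟎 (l * 2)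
    , focusˡ (marks 𝟏 l ++ nothing ∷ []) (nothing ∷ []) , b , unary 𝟏 l ⟫
runOrder zero    j ls rs os refl = refl ◅ refl ◅ refl ◅ done
runOrder (suc n) j ls rs os eq
  rewrite sym (marks-∷ 𝟏 (suc n) ls)
  = refl ◅ refl ◅
    runOrder n (suc j) (glyph 𝟏 ∷ ls) rs (glyph 𝟏 ∷ glyph 𝟏 ∷ os) (trans (+-suc (suc n) j) eq)

-- The argument `p` counts the cells of tape `a` used up so far, and `n` the rows still to come.
pendantRows : ℕ → ℕ → List Symbol
pendantRows p zero    = []
pendantRows p (suc n) =
  (replicate p 𝟎 ++ 𝟏 ∷ 𝟏 ∷ replicate (n * 2) 𝟎 ++ [ comma ]) ++ pendantRows (2 + p) n

runPendantRow : ∀ p n {i P b k} os →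
  ⟪ beforeEnds ∣ i , out os
    , focusˡ (marks 𝟏 p ++ marks 𝟎 (suc n * 2) ++ nothing ∷ []) (nothing ∷ []) , P , b , k ⟫
  ⟶[ (p + suc n * 2) * 2 + 2 ]
  ⟪ pendantRow ∣ i , out (emit (replicate p 𝟎 ++ 𝟏 ∷ 𝟏 ∷ replicate (n * 2) 𝟎 ++ [ comma ]) os)
    , tape (marks 𝟏 (2 + p) ++ marks 𝟎 (n * 2) ++ nothing ∷ []) nothing [] , P , b , k ⟫
runPendantRow p n {i} {P} {b} {k} os
  rewrite emit-++ (replicate p 𝟎) (𝟏 ∷ 𝟏 ∷ replicate (n * 2) 𝟎 ++ [ comma ]) os
        | emit-++ (replicate (n * 2) 𝟎) [ comma ] (glyph 𝟏 ∷ glyph 𝟏 ∷ emit (replicate p 𝟎) os)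
        | sym (marks-∷ 𝟏 (suc p) (marks 𝟎 (n * 2) ++ nothing ∷ []))
        | sym (marks-∷ 𝟏 p (glyph 𝟏 ∷ marks 𝟎 (n * 2) ++ nothing ∷ []))
  = weaken (≤-reflexive (budget p (n * 2)))
  (sweepˡ (λ t os → ⟪ beforeEnds ∣ i , out os , t , P , b , k ⟫) 𝟏 𝟎 (λ _ _ _ → refl ◅ done) p _ _ os
  ◅◅ refl ◅ refl ◅
  sweepˡ (λ t os → ⟪ afterEnds ∣ i , out os , t , P , b , k ⟫) 𝟎 𝟎 (λ _ _ _ → refl ◅ done) (n * 2) _ _ _
  ◅◅ refl ◅
  returnʳ (λ t → ⟪ rewindMarks ∣ i , out os′ , t , P , b , k ⟫) 𝟎 (λ _ _ → refl ◅ done) (n * 2) _ _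
  -- These two steps cross the cells that the present row has turned to `𝟏`.
  ◅◅ refl ◅ refl ◅
  returnʳ (λ t → ⟪ rewindMarks ∣ i , out os′ , t , P , b , k ⟫) 𝟏 (λ _ _ → refl ◅ done) p _ _
  -- `done` fits any bound; the choice of 0 makes the total the left side of `budget`.
  ◅◅ refl ◅ done {t = 0})
  where
  os′ = glyph comma ∷ emit (replicate (n * 2) 𝟎) (glyph 𝟏 ∷ glyph 𝟏 ∷ emit (replicate p 𝟎) os)
  budget : ∀ p n → p + suc (suc (n + suc (n + suc (suc (p + 1))))) ≡ (p + suc (suc n)) * 2 + 2
  budget = solve-∀

runPendantRows : ∀ p n {i b k s} ls rs os → p + n * 2 ≡ s →
  ⟪ pendantRow ∣ i , out os , tape (marks 𝟏 p ++ marks 𝟎 (n * 2) ++ nothing ∷ []) nothing []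
    , focusˡ (marks 𝟏 n ++ ls) rs , b , k ⟫
  ⟶[ n * (s * 2 + 3) ]
  ⟪ pendantRow ∣ i , out (emit (pendantRows p n) os) , unary 𝟏 s , focusˡ ls (marks 𝟏 n ++ rs) , b , k ⟫
runPendantRows p zero ls rs os refl rewrite +-identityʳ p = done
runPendantRows p (suc n) {s = s} ls rs os refl
  rewrite sym (marks-∷ 𝟏 n rs)
        | emit-++ (replicate p 𝟎 ++ 𝟏 ∷ 𝟏 ∷ replicate (n * 2) 𝟎 ++ [ comma ]) (pendantRows (2 + p) n) os
  = weaken (≤-reflexive (cong (_+ n * (s * 2 + 3)) (sym (+-suc (s * 2) 2))))
      (refl ◅ runPendantRow p n os
      ◅◅ runPendantRows (2 + p) n ls (glyph 𝟏 ∷ rs) _ (sym (trans (+-suc p _) (cong suc (+-suc p _)))))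

row : List Bool → List Symbol
row bs = bits bs ++ [ comma ]

length-row : ∀ bs → length (row bs) ≡ suc (length bs)
length-row bs = trans (length-++ (bits bs)) (trans (+-comm _ 1) (cong suc (length-map bit bs)))

module _ (F F′ : Tape Glyph → List Glyph → Configuration)
  (g : Bool → List Symbol) (v : List Symbol) (D D′ : ℕ)
  (move : ∀ b ls rs os →
    F (tape ls (glyph (bit b)) rs) os ⟶[ D ] F (focusʳ (glyph (bit b) ∷ ls) rs) (emit (g b) os))
  (end : ∀ ls rs os →
    F (tape ls (glyph comma) rs) os ⟶[ D′ ] F′ (focusʳ (glyph comma ∷ ls) rs) (emit v os))
  where

  scanRow : ∀ bs ls rs os →
    F (focusʳ ls (glyphs (row bs) ++ rs)) os ⟶[ length bs * D + D′ ]
    F′ (focusʳ (emit (row bs) ls) rs) (emit (concatMap g bs ++ v) os)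
  scanRow bs ls rs os
    rewrite glyphs-++ (bits bs) [ comma ] rs | emit-++ (bits bs) [ comma ] ls | emit-++ (concatMap g bs) v os
    = scanBits F g D move bs ls _ os ◅◅ end _ rs _

-- The steps spent at the comma are charged to the comma itself, so that the cost of a row is
-- proportional to its length, as `scanItems` requires.
length-row-* : ∀ bs {D D′} E → D ≤ E → D′ ≤ E → length bs * D + D′ ≤ length (row bs) * E
length-row-* bs {D} {D′} E D≤E D′≤E rewrite length-row bs =
  ≤-trans (≤-reflexive (+-comm _ D′)) (+-mono-≤ D′≤E (*-monoʳ-≤ (length bs) D≤E))

padded : List Bool → List Symbol
padded bs = concatMap (λ b → bit b ∷ 𝟎 ∷ []) bs ++ [ comma ]

runEdgeRows : ∀ n {a p} bss ls rs os → let m = length bss in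
  ⟪ edgeRow ∣ focusʳ ls (glyphs (concatMap row bss) ++ rs) , out os , a , p , unary 𝟏 0 , unary 𝟏 n ⟫
  ⟶[ length (concatMap row bss) * 2 ]
  ⟪ edgeRow ∣ focusʳ (emit (concatMap row bss) ls) rs , out (emit (concatMap padded bss) os) , a , p
    , unary 𝟏 m , unary 𝟏 (m + n) ⟫
runEdgeRows n {a} {p} bss ls rs os =
  scanItems F row padded 2
    (λ bs j ls rs os → weaken (length-row-* bs 2 ≤-refl (s≤s z≤n))
      (scanRow (F j) (F (suc j)) (λ b → bit b ∷ 𝟎 ∷ []) [ comma ] 2 1
        (λ { false _ _ _ → refl ◅ refl ◅ done ; true _ _ _ → refl ◅ refl ◅ done })
        (λ _ _ _ → refl ◅ done) bs ls rs os))
    bss 0 ls rs os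
  ▻ cong (λ j → F j (focusʳ (emit (concatMap row bss) ls) rs) (emit (concatMap padded bss) os))
      (+-identityʳ (length bss))
  where
  F : ℕ → Tape Glyph → List Glyph → Configuration
  F j t os = ⟪ edgeRow ∣ t , out os , a , p , unary 𝟏 j , unary 𝟏 (j + n) ⟫

runRewindEdges : ∀ {o a p b k w} → All (_≢ semi) w → ∀ ls rs →
  ⟪ rewindEdges ∣ focusˡ (emit w ls) rs , o , a , p , b , k ⟫ ⟶[ length w ]
  ⟪ rewindEdges ∣ focusˡ ls (glyphs w ++ rs) , o , a , p , b , k ⟫
runRewindEdges {o} {a} {p} {b} {k} = returnˡ (λ t → ⟪ rewindEdges ∣ t , o , a , p , b , k ⟫)
  λ { {𝟎}     _ _ _ → refl ◅ done
    ; {𝟏}     _ _ _ → refl ◅ done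
    ; {comma} _ _ _ → refl ◅ done
    ; {semi}  s≢semi _ _ → contradiction refl s≢semi }

-- Each mark of tape `p` costs one step onto the counter `k`, a round trip of `k * 2 + 1` steps and
-- one step to the next mark.
runPendantArcs : ∀ k {i a b} n ls rs os →
  ⟪ pendantArcs ∣ i , out os , a , focusʳ ls (marks 𝟏 n ++ rs) , b , unary 𝟏 k ⟫
  ⟶[ n * (k * 2 + 3) ]
  ⟪ pendantArcs ∣ i , out (emit (concat (replicate n (replicate k 𝟎 ++ [ comma ]))) os) , a
    , focusʳ (marks 𝟏 n ++ ls) rs , b , unary 𝟏 k ⟫
runPendantArcs k {i} {a} {b} =
  sweepʳ (λ t os → ⟪ pendantArcs ∣ i , out os , a , t , b , unary 𝟏 k ⟫) 𝟏 (replicate k 𝟎 ++ [ comma ]) (k * 2 + 3)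
    λ ls rs os → weaken (≤-reflexive (sym (+-suc (k * 2) 2))) (refl ◅ weaken (≤-reflexive (+-assoc (k * 2) 1 1))
      (roundTrip (λ t os → ⟪ pendantZeros ∣ i , out os , a , tape ls (glyph 𝟏) rs , b , t ⟫)
        (λ t os → ⟪ rewindZeros ∣ i , out os , a , tape ls (glyph 𝟏) rs , b , t ⟫) 𝟏 𝟎 [ comma ]
        (λ _ _ _ → refl ◅ done) (λ _ _ → refl ◅ done) (λ _ _ _ → refl ◅ done) k os
      ◅◅ refl ◅ done {t = 0}))

arcRow : ℕ → List Bool → List Symbol
arcRow m bs = concatMap (λ b → [ bit b ]) bs ++ replicate m 𝟎 ++ [ comma ]

runEdgeArcs : ∀ m {a p k} bss ls rs os →
  ⟪ edgeArcs ∣ focusʳ ls (glyphs (concatMap row bss) ++ rs) , out os , a , p , unary 𝟏 m , k ⟫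
  ⟶[ length (concatMap row bss) * (m * 2 + 3) ]
  ⟪ edgeArcs ∣ focusʳ (emit (concatMap row bss) ls) rs , out (emit (concatMap (arcRow m) bss) os) , a , p
    , unary 𝟏 m , k ⟫
runEdgeArcs m {a} {p} {k} bss =
  scanItems (λ _ t os → ⟪ edgeArcs ∣ t , out os , a , p , unary 𝟏 m , k ⟫) row (arcRow m) (m * 2 + 3)
    (λ bs j ls rs os → weaken (length-row-* bs (m * 2 + 3) (≤-trans (s≤s z≤n) (m≤n+m 3 (m * 2))) ≤-refl)
      (scanRow (λ t os → ⟪ edgeArcs ∣ t , out os , a , p , unary 𝟏 m , k ⟫)
        (λ t os → ⟪ edgeArcs ∣ t , out os , a , p , unary 𝟏 m , k ⟫)
        (λ b → [ bit b ]) (replicate m 𝟎 ++ [ comma ]) 1 (m * 2 + 3)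
        (λ { false _ _ _ → refl ◅ done ; true _ _ _ → refl ◅ done })
        end bs ls rs os)) bss 0
  where
  end : ∀ ls rs os →
    ⟪ edgeArcs ∣ tape ls (glyph comma) rs , out os , a , p , unary 𝟏 m , k ⟫ ⟶[ m * 2 + 3 ]
    ⟪ edgeArcs ∣ focusʳ (glyph comma ∷ ls) rs , out (emit (replicate m 𝟎 ++ [ comma ]) os) , a , p , unary 𝟏 m , k ⟫
  end ls rs os = weaken (≤-reflexive (sym (+-suc (m * 2) 2))) (refl ◅ weaken (≤-reflexive (+-assoc (m * 2) 1 1))
    (roundTrip (λ t os → ⟪ edgeZeros ∣ focusʳ (glyph comma ∷ ls) rs , out os , a , p , t , k ⟫)
      (λ t os → ⟪ rewindEdgeZeros ∣ focusʳ (glyph comma ∷ ls) rs , out os , a , p , t , k ⟫) 𝟏 𝟎 [ comma ]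
      (λ _ _ _ → refl ◅ done) (λ _ _ → refl ◅ done) (λ _ _ _ → refl ◅ done) m os
    ◅◅ refl ◅ done {t = 0}))

-- `nothing` is a vertex outside `C`, and `just bs` a vertex of `C` whose bound has the digits `bs`.
labelWord lowerWord : Maybe (List Bool) → List Symbol
labelWord nothing   = 𝟎 ∷ [ comma ]
labelWord (just bs) = 𝟏 ∷ row bs
lowerWord nothing   = 𝟎 ∷ [ comma ]
lowerWord (just bs) = concatMap (λ b → [ bit b ]) bs ++ [ comma ]

upperWord : ℕ → Maybe (List Bool) → List Symbol
upperWord m nothing   = 𝟎 ∷ [ comma ]
upperWord m (just bs) = replicate m 𝟎 ++ [ comma ]

runLower : ∀ {a p b k} labs ls rs os →
  ⟪ lower ∣ focusʳ ls (glyphs (concatMap labelWord labs) ++ rs) , out os , a , p , b , k ⟫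
  ⟶[ length (concatMap labelWord labs) * 1 ]
  ⟪ lower ∣ focusʳ (emit (concatMap labelWord labs) ls) rs , out (emit (concatMap lowerWord labs) os) , a , p , b , k ⟫
runLower {a} {p} {b} {k} labs =
  scanItems (λ _ t os → ⟪ lower ∣ t , out os , a , p , b , k ⟫) labelWord lowerWord 1
    (λ { nothing   _ _ _ _ → refl ◅ refl ◅ done
       ; (just bs) _ ls rs os → refl ◅ weaken (length-row-* bs 1 ≤-refl ≤-refl)
           (scanRow (λ t os → ⟪ lowerNumeral ∣ t , out os , a , p , b , k ⟫)
             (λ t os → ⟪ lower ∣ t , out os , a , p , b , k ⟫)
             (λ b → [ bit b ]) [ comma ] 1 1
             (λ { false _ _ _ → refl ◅ done ; true _ _ _ → refl ◅ done })
             (λ _ _ _ → refl ◅ done) bs (glyph 𝟏 ∷ ls) rs os) })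
    labs 0

runLowerCommas : ∀ m {i a p k} os →
  ⟪ lowerCommas ∣ i , out os , a , p , focusˡ (marks 𝟏 m ++ nothing ∷ []) (nothing ∷ []) , k ⟫ ⟶[ m * 2 + 1 ]
  ⟪ rewindCommas ∣ i , out (emit (replicate m comma ++ [ semi ]) os) , a , p , unary 𝟏 m , k ⟫
runLowerCommas m {i} {a} {p} {k} =
  roundTrip (λ t os → ⟪ lowerCommas ∣ i , out os , a , p , t , k ⟫)
    (λ t os → ⟪ rewindCommas ∣ i , out os , a , p , t , k ⟫) 𝟏 comma [ semi ]
    (λ _ _ _ → refl ◅ done) (λ _ _ → refl ◅ done) (λ _ _ _ → refl ◅ done) m

runRewindLabels : ∀ {o a p b k w} → All (_≢ semi) w → ∀ ls rs →
  ⟪ rewindLabels ∣ focusˡ (emit w ls) rs , o , a , p , b , k ⟫ ⟶[ length w ]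
  ⟪ rewindLabels ∣ focusˡ ls (glyphs w ++ rs) , o , a , p , b , k ⟫
runRewindLabels {o} {a} {p} {b} {k} = returnˡ (λ t → ⟪ rewindLabels ∣ t , o , a , p , b , k ⟫)
  λ { {𝟎}     _ _ _ → refl ◅ done
    ; {𝟏}     _ _ _ → refl ◅ done
    ; {comma} _ _ _ → refl ◅ done
    ; {semi}  s≢semi _ _ → contradiction refl s≢semi }

runUpperCommas : ∀ m {i a p k} ls rs os →
  ⟪ upperCommas ∣ i , out os , a , p , focusˡ (marks 𝟏 m ++ ls) rs , k ⟫ ⟶[ m ]
  ⟪ upperCommas ∣ i , out (emit (replicate m comma) os) , a , p , focusˡ ls (marks 𝟏 m ++ rs) , k ⟫
runUpperCommas m {i} {a} {p} {k} =
  sweepˡ (λ t os → ⟪ upperCommas ∣ i , out os , a , p , t , k ⟫) 𝟏 comma (λ _ _ _ → refl ◅ done) m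

runUpper : ∀ m {a p k} labs ls rs os →
  ⟪ upper ∣ focusʳ ls (glyphs (concatMap labelWord labs) ++ rs) , out os , a , p , unary 𝟏 m , k ⟫
  ⟶[ length (concatMap labelWord labs) * (m * 2 + 3) ]
  ⟪ upper ∣ focusʳ (emit (concatMap labelWord labs) ls) rs , out (emit (concatMap (upperWord m) labs) os) , a , p
    , unary 𝟏 m , k ⟫
runUpper m {a} {p} {k} labs =
  scanItems (λ _ t os → ⟪ upper ∣ t , out os , a , p , unary 𝟏 m , k ⟫) labelWord (upperWord m) (m * 2 + 3)
    (λ { nothing   _ _ _ _ → weaken (*-monoʳ-≤ 2 {1} 1≤D) (refl ◅ refl ◅ done)
       -- The round trip on tape `b` is charged to the leading `𝟏` of the label; skipping the rest
       -- takes one step per symbol.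
       ; (just bs) _ ls rs os → weaken (+-monoʳ-≤ (m * 2 + 3) (length-row-* bs (m * 2 + 3) 1≤D 1≤D))
           (numeral⁺ bs ls rs os
            ◅◅ scanRow (λ t os → ⟪ skipLabel ∣ t , out os , a , p , unary 𝟏 m , k ⟫)
             (λ t os → ⟪ upper ∣ t , out os , a , p , unary 𝟏 m , k ⟫)
             (λ _ → []) [ comma ] 1 1
             (λ { false _ _ _ → refl ◅ done ; true _ _ _ → refl ◅ done })
             (λ _ _ _ → refl ◅ done) bs (glyph 𝟏 ∷ ls) rs (emit (replicate m 𝟎 ++ []) os)
            -- The round trip turns with the empty word, and the scan emits the empty word for each
            -- skipped digit; both are cancelled here.
            ▻ cong (λ os′ → ⟪ upper ∣ focusʳ (emit (labelWord (just bs)) ls) rs , out os′ , a , p , unary 𝟏 m , k ⟫)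
                (trans (cong₂ (λ v w → emit (w ++ [ comma ]) (emit v os)) (++-identityʳ (replicate m 𝟎)) (concatMap-[] bs))
                       (sym (emit-++ (replicate m 𝟎) [ comma ] os)))) })
    labs 0
  where
  1≤D : 1 ≤ m * 2 + 3
  1≤D = ≤-trans (s≤s z≤n) (m≤n+m 3 (m * 2))
  concatMap-[] : ∀ (bs : List Bool) → concatMap (λ _ → []) bs ≡ []
  concatMap-[] []       = refl
  concatMap-[] (_ ∷ bs) = concatMap-[] bs
  numeral⁺ : ∀ bs ls rs os →
    ⟪ upper ∣ tape ls (glyph 𝟏) (glyphs (row bs) ++ rs) , out os , a , p , unary 𝟏 m , k ⟫ ⟶[ m * 2 + 3 ]
    ⟪ skipLabel ∣ focusʳ (glyph 𝟏 ∷ ls) (glyphs (row bs) ++ rs) , out (emit (replicate m 𝟎 ++ []) os) , a , p , unary 𝟏 m , k ⟫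
  numeral⁺ bs ls rs os = weaken (≤-reflexive (sym (+-suc (m * 2) 2))) (refl ◅ weaken (≤-reflexive (+-assoc (m * 2) 1 1))
    (roundTrip (λ t os → ⟪ upperNumeral ∣ focusʳ (glyph 𝟏 ∷ ls) (glyphs (row bs) ++ rs) , out os , a , p , t , k ⟫)
      (λ t os → ⟪ rewindNumeral ∣ focusʳ (glyph 𝟏 ∷ ls) (glyphs (row bs) ++ rs) , out os , a , p , t , k ⟫) 𝟏 𝟎 []
      (λ _ _ _ → refl ◅ done) (λ _ _ → refl ◅ done) (λ _ _ _ → refl ◅ done) m os
    ◅◅ refl ◅ done {t = 0}))

-- The complete run and its quadratic bound

inputWord : ℕ → List (List Bool) → List (Maybe (List Bool)) → List Symbol
inputWord n bss labs =
  replicate n 𝟏 ++ semi ∷ concatMap row bss ++ semi ∷ concatMap labelWord labs ++ [ semi ]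

-- Cut where one stretch of the run hands over to the next, so that `emit-concat` yields nested
-- emissions that match the passes of `run` by computation.
outputWords : ℕ → List (List Bool) → List (Maybe (List Bool)) → List (List Symbol)
outputWords n bss labs = let m = length bss in
    (replicate (n * 2) 𝟏 ++ [ semi ]) ∷ pendantRows 0 n ∷ concatMap padded bss ∷ [ semi ]
  ∷ concat (replicate n (replicate (m + n) 𝟎 ++ [ comma ])) ∷ concatMap (arcRow m) bss ∷ [ semi ]
  ∷ concatMap lowerWord labs ∷ (replicate m comma ++ [ semi ])
  ∷ concatMap (upperWord m) labs ∷ replicate m comma ∷ [ semi ] ∷ []

outputWord : ℕ → List (List Bool) → List (Maybe (List Bool)) → List Symbol
outputWord n bss labs = concat (outputWords n bss labs)

emit-concat : ∀ ws os → emit (concat ws) os ≡ foldl (λ os w → emit w os) os ws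
emit-concat []       os = refl
emit-concat (w ∷ ws) os = trans (emit-++ w (concat ws) os) (emit-concat ws (emit w os))

bits-≢semi : ∀ bs → All (_≢ semi) (bits bs)
bits-≢semi bs = Allₚ.map⁺ (All.universal (λ { false () ; true () }) bs)

row-≢semi : ∀ bs → All (_≢ semi) (row bs)
row-≢semi bs = Allₚ.++⁺ (bits-≢semi bs) ((λ ()) ∷ [])

labelWord-≢semi : ∀ lab → All (_≢ semi) (labelWord lab)
labelWord-≢semi nothing   = (λ ()) ∷ (λ ()) ∷ []
labelWord-≢semi (just bs) = (λ ()) ∷ row-≢semi bs

concatMap-≢semi : ∀ {A : Set} {f : A → List Symbol} → (∀ x → All (_≢ semi) (f x)) →
  ∀ xs → All (_≢ semi) (concatMap f xs)
concatMap-≢semi p xs = Allₚ.concat⁺ (Allₚ.map⁺ (All.universal p xs))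

-- `r` and `l` are the lengths of the edge rows and of the labels. The nesting copies that of `run`,
-- whose step count is then this very expression.
runTime : (n m r l : ℕ) → ℕ
runTime n m r l = suc ((n * 2 + 1) + (n * (n * 2 * 2 + 3) + suc (r * 2 + suc (r + suc
  (n * ((m + n) * 2 + 3) + suc (r * (m * 2 + 3) + suc (l * 1 + suc ((m * 2 + 1) + suc
  (l + suc (l * (m * 2 + 3) + suc (m + 1)))))))))))

-- The factor 6 is set by `n * n`: 4 from writing the pendant rows of the incidence matrix, 2 from
-- those of the arc matrix. The number of edges enters the input length only through `r`.
runTime-≤ : ∀ n {m r} l → m ≤ r → runTime n m r l ≤ 6 * (n + suc (r + suc (l + 1))) ^ 2 + 6
runTime-≤ n {m} {r} l m≤r with m≤n⇒∃[o]m+o≡n m≤r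
... | x , refl = m+n≤o⇒m≤o _ (≤-reflexive (identity n m x l))
  where
  -- The second summand is the difference of the two sides for r = m + x.
  identity : ∀ n m x l →
    suc ((n * 2 + 1) + (n * (n * 2 * 2 + 3) + suc ((m + x) * 2 + suc ((m + x) + suc
    (n * ((m + n) * 2 + 3) + suc ((m + x) * (m * 2 + 3) + suc (l * 1 + suc ((m * 2 + 1) + suc
    (l + suc (l * (m * 2 + 3) + suc (m + 1)))))))))))
    + (10 * m * n + 12 * n * x + 12 * l * n + 28 * n + 4 * m * m + 10 * m * x + 10 * l * m + 27 * m
       + 6 * x * x + 12 * l * x + 30 * x + 6 * l * l + 31 * l + 47)
    ≡ 6 * ((n + suc ((m + x) + suc (l + 1))) * ((n + suc ((m + x) + suc (l + 1))) * 1)) + 6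
  identity = solve-∀

module _ (n : ℕ) (bss : List (List Bool)) (labs : List (Maybe (List Bool))) where
  private
    m = length bss
    R = concatMap row bss
    W = concatMap labelWord labs

  glyphs-input : glyphs (replicate n 𝟏 ++ semi ∷ R ++ semi ∷ W ++ [ semi ]) ≡
    marks 𝟏 n ++ glyph semi ∷ glyphs R ++ glyph semi ∷ glyphs W ++ glyph semi ∷ []
  glyphs-input
    rewrite map-++ {B = Glyph} (λ s → glyph s) (replicate n 𝟏) (semi ∷ R ++ semi ∷ W ++ [ semi ])
          | map-replicate {B = Glyph} (λ s → glyph s) n 𝟏
          | map-++ {B = Glyph} (λ s → glyph s) R (semi ∷ W ++ [ semi ])
          | map-++ {B = Glyph} (λ s → glyph s) W [ semi ] = refl

  run : ∃[ i ] ∃[ a ] ∃[ p ] ∃[ b ] ∃[ k ]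
    initial reduction (inputWord (suc n) bss labs) ⟶[ runTime (suc n) m (length R) (length W) ]
    ⟪ finished ∣ i , out (emit (outputWord (suc n) bss labs) []) , a , p , b , k ⟫
  run rewrite emit-concat (outputWords (suc n) bss labs) [] | glyphs-input =
    _ , _ , _ , _ , _ , refl ◅
    (runOrder n 0 [] _ [] (+-identityʳ (suc n))
    ◅◅ runPendantRows 0 (suc n) (nothing ∷ []) (nothing ∷ []) _ refl
    ◅◅ refl ◅ runEdgeRows (suc n) bss _ (glyph semi ∷ glyphs W ++ glyph semi ∷ []) _
    ◅◅ refl ◅ runRewindEdges (concatMap-≢semi row-≢semi bss) _ _
    ◅◅ refl ◅ runPendantArcs (m + suc n) (suc n) (nothing ∷ []) (nothing ∷ []) _
    ◅◅ refl ◅ runEdgeArcs m bss _ (glyph semi ∷ glyphs W ++ glyph semi ∷ []) _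
    ◅◅ refl ◅ runLower labs _ (glyph semi ∷ []) _
    ◅◅ refl ◅ runLowerCommas m _
    ◅◅ refl ◅ runRewindLabels (concatMap-≢semi labelWord-≢semi labs) _ _
    ◅◅ refl ◅ runUpper m labs _ (glyph semi ∷ []) _
    ◅◅ refl ◅ runUpperCommas m (nothing ∷ []) (nothing ∷ []) _
    ◅◅ refl ◅ done)

  length-input : length (inputWord (suc n) bss labs) ≡ suc n + suc (length R + suc (length W + 1))
  length-input
    rewrite length-++ (replicate (suc n) 𝟏) {semi ∷ R ++ semi ∷ W ++ [ semi ]}
          | length-replicate n {𝟏} | length-++ R {semi ∷ W ++ [ semi ]} | length-++ W {[ semi ]} = refl

  m≤length-R : m ≤ length R
  m≤length-R = go bss
    where
    go : ∀ bss → length bss ≤ length (concatMap row bss)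
    go []         = z≤n
    go (bs ∷ bss) rewrite length-++ (row bs) {concatMap row bss} | length-row bs =
      s≤s (≤-trans (go bss) (m≤n+m _ (length bs)))

  computes : let v = inputWord (suc n) bss labs in
    Computes reduction v (outputWord (suc n) bss labs) (6 * length v ^ 2 + 6)
  computes with run
  ... | _ , _ , _ , _ , _ , r with halts r refl
  -- The witnesses 0 and 1: no blank precedes the output, and the blank under the head follows it.
  ...   | t , t≤ , h = t , _ , _ , ≤-trans t≤ bound , h , 0 , 1 ,
            cong (_++ nothing ∷ []) (reverse-involutive (glyphs (outputWord (suc n) bss labs)))
    where
    bound : runTime (suc n) m (length R) (length W) ≤ 6 * length (inputWord (suc n) bss labs) ^ 2 + 6
    bound = subst (λ L → runTime (suc n) m (length R) (length W) ≤ 6 * L ^ 2 + 6) (sym length-input)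
      (runTime-≤ (suc n) (length W) m≤length-R)

-- The instance computed by the machine

-- This is how the pendant edges drop out of the count that is compared with the bounds.
∣tabulate∩++∣ : ∀ {n m} (f : Fin (n + m) → Bool) (P : Subset n) (T : Subset m) →
  (∀ v → f (v ↑ˡ m) ≡ false) →
  ∣ Vec.tabulate f ∩ (P Vec.++ T) ∣ ≡ ∣ Vec.tabulate (λ e → f (n ↑ʳ e)) ∩ T ∣
∣tabulate∩++∣ f []      T f≡false = refl
∣tabulate∩++∣ f (p ∷ P) T f≡false rewrite f≡false zero = ∣tabulate∩++∣ (f ∘ suc) P T (f≡false ∘ suc)

∣tabulate∩∣≡0 : ∀ {m} (f : Fin m → Bool) (T : Subset m) → (∀ e → f e ≡ false) → ∣ Vec.tabulate f ∩ T ∣ ≡ 0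
∣tabulate∩∣≡0 f []      f≡false = refl
∣tabulate∩∣≡0 f (t ∷ T) f≡false rewrite f≡false zero = ∣tabulate∩∣≡0 (f ∘ suc) T (f≡false ∘ suc)

-- In bijective base 2, `m` digits 1 denote `2 ^ m ∸ 1`.
repunit : ℕ → ℕᵇ
repunit zero    = 0ᵇ
repunit (suc m) = 1+[2 repunit m ]

m≤repunit : ∀ m → m ≤ toℕ (repunit m)
m≤repunit zero    = z≤n
m≤repunit (suc m) = s≤s (≤-trans (m≤repunit m) (m≤m+n _ _))

numeral-repunit : ∀ m → numeral (toℕ (repunit m)) ≡ replicate m 𝟎
numeral-repunit m rewrite fromℕ-toℕ (repunit m) = go m
  where
  go : ∀ m → numeralᵇ (repunit m) ≡ replicate m 𝟎
  go zero    = refl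
  go (suc m) = cong (𝟎 ∷_) (go m)

digits : ℕᵇ → List Bool
digits 0ᵇ       = []
digits 1+[2 b ] = false ∷ digits b
digits 2[1+ b ] = true ∷ digits b

bits-digits : ∀ b → bits (digits b) ≡ numeralᵇ b
bits-digits 0ᵇ       = refl
bits-digits 1+[2 b ] = cong (𝟎 ∷_) (bits-digits b)
bits-digits 2[1+ b ] = cong (𝟏 ∷_) (bits-digits b)

tabulate-+ : ∀ {A : Set} n {m} (f : Fin (n + m) → A) →
  tabulate f ≡ tabulate (λ v → f (v ↑ˡ m)) ++ tabulate (λ e → f (n ↑ʳ e))
tabulate-+ zero    f = refl
tabulate-+ (suc n) f = cong (f zero ∷_) (tabulate-+ n (f ∘ suc))

tabulate-const : ∀ {A : Set} n (x : A) → tabulate {n = n} (const x) ≡ replicate n x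
tabulate-const zero    x = refl
tabulate-const (suc n) x = cong (x ∷_) (tabulate-const n x)

tabulate-lookup-Vec : ∀ {A : Set} {n} (xs : Vec A n) → tabulate (lookup xs) ≡ toList xs
tabulate-lookup-Vec []       = refl
tabulate-lookup-Vec (x ∷ xs) = cong (x ∷_) (tabulate-lookup-Vec xs)

concat-tabulate : ∀ {A : Set} {n} {f : Fin n → List Symbol} (g : A → List Symbol) (h : Fin n → A) →
  (∀ i → f i ≡ g (h i)) → concat (tabulate f) ≡ concatMap g (tabulate h)
concat-tabulate g h f≗g∘h = cong concat (trans (tabulate-cong f≗g∘h) (sym (map-tabulate h g)))

section-+ : ∀ n {m} (f : Fin (n + m) → List Symbol) →
  section f ≡ concat (tabulate (λ v → f (v ↑ˡ m) ++ [ comma ])) ++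
              concat (tabulate (λ e → f (n ↑ʳ e) ++ [ comma ])) ++ [ semi ]
section-+ n {m} f = trans
  (cong (_++ [ semi ]) (trans (cong concat (tabulate-+ n (λ i → f i ++ [ comma ]))) (sym (concat-++ left′ right′))))
  (++-assoc (concat left′) (concat right′) [ semi ])
  where
  left′ right′ : List (List Symbol)
  left′  = tabulate (λ v → f (v ↑ˡ m) ++ [ comma ])
  right′ = tabulate (λ e → f (n ↑ʳ e) ++ [ comma ])

bits-false : ∀ k → bits (replicate k false) ≡ replicate k 𝟎
bits-false k = map-replicate bit k false

concatMap-bit : ∀ bs → concatMap (λ b → [ bit b ]) bs ≡ bits bs
concatMap-bit bs = trans (sym (concatMap-map [_] bit bs)) (concatMap-pure (bits bs))

row-twice : ∀ {n} (p : Subset n) → row (toList (twice p)) ≡ padded (toList p)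
row-twice []      = refl
row-twice (b ∷ p) = cong (λ w → bit b ∷ 𝟎 ∷ w) (row-twice p)

toList-empty : ∀ n → toList (empty {n}) ≡ replicate n false
toList-empty zero    = refl
toList-empty (suc n) = cong (false ∷_) (toList-empty n)

replicate-++-∷ : ∀ {A : Set} n (x : A) xs → replicate n x ++ x ∷ xs ≡ x ∷ replicate n x ++ xs
replicate-++-∷ zero    x xs = refl
replicate-++-∷ (suc n) x xs = cong (x ∷_) (replicate-++-∷ n x xs)

-- Passing to the next vertex puts two more zero bits in front of `ends`; the prefix of `p` zeros
-- absorbs them in the induction.
pendantRows≡ : ∀ p n → concat (tabulate {n = n} (λ v → replicate p 𝟎 ++ row (toList (ends v)))) ≡ pendantRows p n
pendantRows≡ p zero    = refl
pendantRows≡ p (suc n) = cong₂ (λ v w → (replicate p 𝟎 ++ 𝟏 ∷ 𝟏 ∷ v ++ [ comma ]) ++ w)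
  (trans (cong bits (toList-empty (n * 2))) (bits-false (n * 2)))
  (trans (cong concat (tabulate-cong {n = n} (λ v →
     trans (replicate-++-∷ p 𝟎 _) (cong (𝟎 ∷_) (replicate-++-∷ p 𝟎 _)))))
   (pendantRows≡ (2 + p) n))

-- The sections of the encoding are cut differently from the passes that write them. Only the
-- bracketing differs, and over variables the monoid solver settles it.
regroup : ∀ (s a b c d e f g h k : List Symbol) →
  (a ++ s ++ b ++ c ++ s) ++ (d ++ e ++ s) ++ (f ++ g ++ s) ++ (h ++ k ++ s) ≡
  concat ((a ++ s) ∷ b ∷ c ∷ s ∷ d ∷ e ∷ s ∷ f ∷ (g ++ s) ∷ h ∷ k ∷ s ∷ [])
regroup s a b c d e f g h k = solve (++-monoid Symbol)

-- Correctness of the reduced instance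

module Reduction (I : FmDSTInstance) where
  open FmDSTInstance I hiding (IsSolution) renaming (order to n; size to m)
  open Pendant G

  arc : Fin n ⊎ Fin m → Fin n ⊎ Fin m → Bool
  arc (inj₂ e) (inj₁ v) = lookup (edge e) v
  arc _        _        = false

  D⁺ : Digraph (n + m)
  D⁺ = record
    { arc      = λ i j → arc (splitAt n i) (splitAt n j)
    ; loopless = λ i → loopless (splitAt n i)
    }
    where
    loopless : ∀ s → arc s s ≡ false
    loopless (inj₁ _) = refl
    loopless (inj₂ _) = refl

  -- Outside `C` both bounds are 1, which forces the degree to be 1.
  least most : Fin n → ℕ
  least v with v ∈? C
  ... | yes v∈C = ℓ v∈C
  ... | no  _   = 1
  most v with v ∈? C
  ... | yes _ = toℕ (repunit m)
  ... | no  _ = 1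

  -- The numeral of 2 ^ m ∸ 1 consists of m equal digits, and no degree exceeds this number.
  image : GDCSTInstance
  image = record
    { G = G⁺
    ; D = D⁺
    ; ℓ = λ i → [ least , const 0 ]′ (splitAt n i)
    ; u = λ i → [ most , const 0 ]′ (splitAt n i)
    }

  open GDCSTInstance image using () renaming (ℓ to ℓ⁺; u to u⁺)

  -- The arcs into the pendant edge at `v` come from the edges of `G` at `v`, the set that `degree`
  -- intersects with `T`.
  dep-pendant : ∀ v (P : Subset n) T → ∣ dep D⁺ (v ↑ˡ m) ∩ (P Vec.++ T) ∣ ≡ degree G T v
  dep-pendant v P T rewrite splitAt-↑ˡ n v m = trans
    (∣tabulate∩++∣ (λ i → arc (splitAt n i) (inj₁ v)) P T (λ w → cong (λ s → arc s (inj₁ v)) (splitAt-↑ˡ n w m)))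
    (cong (λ p → ∣ p ∩ T ∣) (Vecₚ.tabulate-cong (λ e → cong (λ s → arc s (inj₁ v)) (splitAt-↑ʳ n m e))))

  -- No arc ends in an edge of `G`, so its bounds 0 and 0 are always met.
  dep-edge : ∀ e H → ∣ dep D⁺ (n ↑ʳ e) ∩ H ∣ ≡ 0
  dep-edge e H rewrite splitAt-↑ʳ n m e = ∣tabulate∩∣≡0 _ H (λ i → arc-edge (splitAt n i))
    where
    arc-edge : ∀ s → arc s (inj₂ e) ≡ false
    arc-edge (inj₁ _) = refl
    arc-edge (inj₂ _) = refl

  satisfies⁺ : ∀ {T} → (∀ {v} (v∈C : v ∈ C) → ℓ v∈C ≤ degree G T v) → (∀ {v} → v ∉ C → degree G T v ≡ 1) →
    ∀ P → Satisfies D⁺ ℓ⁺ u⁺ (P Vec.++ T)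
  satisfies⁺ {T} deg≥ deg≡1 P i _ with summand n i
  ... | inʳ e rewrite dep-edge e (P Vec.++ T) = subst (_≤ 0) (sym (cong [ least , const 0 ]′ (splitAt-↑ʳ n m e))) z≤n , z≤n
  ... | inˡ v rewrite dep-pendant v P T | splitAt-↑ˡ n v m with v ∈? C
  ...   | yes v∈C = deg≥ v∈C , ≤-trans (∣p∣≤n (Vec.tabulate (λ e → lookup (edge e) v) ∩ T)) (m≤repunit m)
  ...   | no  v∉C = ≤-reflexive (sym (deg≡1 v∉C)) , ≤-reflexive (deg≡1 v∉C)

  degree-bounds : ∀ {P T} → Satisfies D⁺ ℓ⁺ u⁺ (P Vec.++ T) → (∀ v → v ∈ P) →
    ∀ v → least v ≤ degree G T v × degree G T v ≤ most v
  degree-bounds {P} {T} sat v∈P v with sat (v ↑ˡ m) (∈-++ˡ⁺ (v∈P v))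
  ... | bounds rewrite dep-pendant v P T | splitAt-↑ˡ n v m = bounds

  -- `ℓ` takes a proof of membership. The one found by `∈?` need not be the given one, but any two
  -- such proofs are equal.
  least-∈ : ∀ {v} (v∈C : v ∈ C) → least v ≡ ℓ v∈C
  least-∈ {v} v∈C with v ∈? C
  ... | yes v∈C′ = cong ℓ ([]=-irrelevant v∈C′ v∈C)
  ... | no  v∉C  = contradiction v∈C v∉C

  bounds-∉ : ∀ {v d} → v ∉ C → least v ≤ d × d ≤ most v → d ≡ 1
  bounds-∉ {v} v∉C (1≤d , d≤1) with v ∈? C
  ... | yes v∈C = contradiction v∈C v∉C
  ... | no  _   = ≤-antisym d≤1 1≤d

  correct : ∃ (FmDSTInstance.IsSolution I) ⇔ ∃ (GDCSTInstance.IsSolution image)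
  correct = mk⇔
    (λ (T , tree , deg≥ , deg≡1) → full Vec.++ T , spanningTree⁺ tree , satisfies⁺ deg≥ deg≡1 full)
    (λ (H , tree , sat) → let P , T , H≡P++T = Vec.splitAt n H in
      from P T (subst (IsSpanningTree G⁺) H≡P++T tree) (subst (Satisfies D⁺ ℓ⁺ u⁺) H≡P++T sat))
    where
    from : ∀ P T → IsSpanningTree G⁺ (P Vec.++ T) → Satisfies D⁺ ℓ⁺ u⁺ (P Vec.++ T) →
      ∃ (FmDSTInstance.IsSolution I)
    from P T tree sat = T , spanningTree⁻ {P = P} tree ,
      (λ {v} v∈C → subst (_≤ degree G T v) (least-∈ v∈C) (proj₁ (bounds v))) ,
      (λ {v} v∉C → bounds-∉ v∉C (bounds v))
      where
      bounds : ∀ v → least v ≤ degree G T v × degree G T v ≤ most v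
      bounds = degree-bounds sat (pendant-forced {P = P} {T} (proj₁ tree))

  -- The encoding of the reduced instance

  lab : Fin n → Maybe (List Bool)
  lab v with v ∈? C
  ... | yes v∈C = just (digits (fromℕ (ℓ v∈C)))
  ... | no  _   = nothing

  rows : List (List Bool)
  rows = tabulate (toList ∘ edge)

  labs : List (Maybe (List Bool))
  labs = tabulate lab

  encode-FmDST : DecisionProblem.encode FmDST I ≡ inputWord n rows labs
  encode-FmDST = trans (++-assoc (replicate n 𝟏) _ _) (cong (λ w → replicate n 𝟏 ++ semi ∷ w)
    (trans (++-assoc (concat (tabulate (λ e → row (toList (edge e))))) [ semi ] (section label))
      (cong₂ (λ v w → v ++ semi ∷ w ++ [ semi ])
        (concat-tabulate row (toList ∘ edge) (λ _ → refl))
        (concat-tabulate labelWord lab label-row))))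
    where
    label-row : ∀ v → label v ++ [ comma ] ≡ labelWord (lab v)
    label-row v with v ∈? C
    ... | yes v∈C = cong (λ w → 𝟏 ∷ w ++ [ comma ]) (sym (bits-digits (fromℕ (ℓ v∈C))))
    ... | no  _   = refl

  encodeGraph⁺ : encodeGraph G⁺ ≡
    replicate (n * 2) 𝟏 ++ [ semi ] ++ pendantRows 0 n ++ concatMap padded rows ++ [ semi ]
  encodeGraph⁺ = cong (λ w → replicate (n * 2) 𝟏 ++ semi ∷ w) (trans (section-+ n _) (cong₂ (λ v w → v ++ w ++ [ semi ])
    (trans (cong concat (tabulate-cong (λ v → cong (row ∘ toList) (edge⁺-pendant v)))) (pendantRows≡ 0 n))
    (concat-tabulate padded (toList ∘ edge) (λ e → trans (cong (row ∘ toList) (edge⁺-edge e)) (row-twice (edge e))))))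

  encodeDigraph⁺ : encodeDigraph D⁺ ≡
    concat (replicate n (replicate (m + n) 𝟎 ++ [ comma ])) ++ concatMap (arcRow m) rows ++ [ semi ]
  encodeDigraph⁺ = trans (section-+ n _) (cong₂ (λ v w → v ++ w ++ [ semi ])
    (cong concat (trans (tabulate-cong pendant-row) (tabulate-const n _)))
    (concat-tabulate (arcRow m) (toList ∘ edge) edge-row))
    where
    open Digraph D⁺ using () renaming (arc to arc⁺)
    pendant-row : ∀ v → row (tabulate (arc⁺ (v ↑ˡ m))) ≡ replicate (m + n) 𝟎 ++ [ comma ]
    pendant-row v rewrite splitAt-↑ˡ n v m | tabulate-const (n + m) false | bits-false (n + m) | +-comm n m = refl
    edge-row : ∀ e → row (tabulate (arc⁺ (n ↑ʳ e))) ≡ arcRow m (toList (edge e))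
    edge-row e
      rewrite splitAt-↑ʳ n m e
            | tabulate-+ n {m} (λ j → arc (inj₂ e) (splitAt n j))
            | tabulate-cong (λ v → cong (arc (inj₂ e)) (splitAt-↑ˡ n v m))
            | tabulate-cong (λ f → cong (arc (inj₂ e)) (splitAt-↑ʳ n m f))
            | tabulate-lookup-Vec (edge e) | tabulate-const m false
            | map-++ bit (toList (edge e)) (replicate m false) | bits-false m
            | concatMap-bit (toList (edge e)) = ++-assoc (bits (toList (edge e))) _ _

  -- The counterpart of `lowerCommas` and `upperCommas`: the numeral of 0 is empty.
  edge-commas : ∀ (f : Fin n → ℕ) →
    concat (tabulate {n = m} (λ e → numeral ([ f , const 0 ]′ (splitAt n (n ↑ʳ e))) ++ [ comma ])) ≡
    replicate m comma
  edge-commas f = trans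
    (cong concat (trans (tabulate-cong λ e → cong (λ s → numeral ([ f , const 0 ]′ s) ++ [ comma ]) (splitAt-↑ʳ n m e))
      (trans (tabulate-const m [ comma ]) (sym (map-replicate [_] m comma)))))
    (concat-map-[_] (replicate m comma))

  encode-ℓ⁺ : section (λ i → numeral (ℓ⁺ i)) ≡ concatMap lowerWord labs ++ replicate m comma ++ [ semi ]
  encode-ℓ⁺ = trans (section-+ n _) (cong₂ (λ v w → v ++ w ++ [ semi ])
    (concat-tabulate lowerWord lab least-row)
    (edge-commas least))
    where
    least-row : ∀ v → numeral (ℓ⁺ (v ↑ˡ m)) ++ [ comma ] ≡ lowerWord (lab v)
    least-row v rewrite splitAt-↑ˡ n v m with v ∈? C
    ... | yes v∈C = cong (_++ [ comma ]) (sym (trans (concatMap-bit _) (bits-digits (fromℕ (ℓ v∈C)))))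
    ... | no  _   = refl

  encode-u⁺ : section (λ i → numeral (u⁺ i)) ≡ concatMap (upperWord m) labs ++ replicate m comma ++ [ semi ]
  encode-u⁺ = trans (section-+ n _) (cong₂ (λ v w → v ++ w ++ [ semi ])
    (concat-tabulate (upperWord m) lab most-row)
    (edge-commas most))
    where
    most-row : ∀ v → numeral (u⁺ (v ↑ˡ m)) ++ [ comma ] ≡ upperWord m (lab v)
    most-row v rewrite splitAt-↑ˡ n v m with v ∈? C
    ... | yes v∈C = cong (_++ [ comma ]) (numeral-repunit m)
    ... | no  _   = refl

  encode-image : DecisionProblem.encode G-DCST image ≡ outputWord n rows labs
  encode-image rewrite encodeGraph⁺ | encodeDigraph⁺ | encode-ℓ⁺ | encode-u⁺ | length-tabulate (toList ∘ edge) =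
    regroup [ semi ] (replicate (n * 2) 𝟏) (pendantRows 0 n) (concatMap padded rows)
      (concat (replicate n (replicate (m + n) 𝟎 ++ [ comma ]))) (concatMap (arcRow m) rows)
      (concatMap lowerWord labs) (replicate m comma) (concatMap (upperWord m) labs) (replicate m comma)

computes-image : ∀ I → let w = DecisionProblem.encode FmDST I in
  Computes reduction w (DecisionProblem.encode G-DCST (Reduction.image I)) (6 * length w ^ 2 + 6)
computes-image I rewrite Reduction.encode-FmDST I | Reduction.encode-image I
  -- After the rewriting, both words depend on the order, rows and labels alone, which can thus be
  -- abstracted; `nonempty` excludes the order 0 and leaves the form `suc n` of `computes`.
  with FmDSTInstance.order I | FmDSTInstance.nonempty I | Reduction.rows I | Reduction.labs I
... | suc n | _ | rows | labs = computes n rows labs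

theorem11 : FmDST ≤ₚ G-DCST
theorem11 = Reduction.image , Reduction.correct , reduction , 6 , 2 , computes-image
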